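{- The stashing operation $f\mapsto\Sigma f$ is an interior operator with respect to each of the reducibilities $\leq_{\mathrm W}$, $\leq_{\mathrm{sW}}$, $\leq_{\mathrm W}^*$ and $\leq_{\mathrm{sW}}^*$. That is, writing $\leq$ for any one of these four relations, for all problems $f,g$: (1) $\Sigma f\leq f$; (2) $f\leq g$ implies $\Sigma f\leq\Sigma g$; (3) $\Sigma f\leq\Sigma\Sigma f$.
   Context: A represented space is a set $X$ with a partial surjective map $\delta_X:\subseteq\mathbb N^{\mathbb N}\to X$ (its representation); $p$ with $\delta_X(p)=x$ is called a name of $x$. A problem is a partial multi-valued function $f:\subseteq X\rightrightarrows Y$ between represented spaces that has a realizer; a realizer of $f$ is a function $F:\subseteq\mathbb N^{\mathbb N}\to\mathbb N^{\mathbb N}$ with $\delta_YF(p)\in f\delta_X(p)$ for all $p\in\mathrm{dom}(f\delta_X)$. For $p,q\in\mathbb N^{\mathbb N}$, $\langle p,q\rangle(2n)=p(n)$ and $\langle p,q\rangle(2n+1)=q(n)$. For problems $f,g$: $f\leq_{\mathrm W}g$ if there are computable $H,K:\subseteq\mathbb N^{\mathbb N}\to\mathbb N^{\mathbb N}$ such that $H\langle\mathrm{id},GK\rangle$ is a realizer of $f$ whenever $G$ is a realizer of $g$; $f\leq_{\mathrm{sW}}g$ is defined in the same way with $HGK$ instead of $H\langle\mathrm{id},GK\rangle$. The topological versions $\leq_{\mathrm W}^*$ and $\leq_{\mathrm{sW}}^*$ are defined with continuous instead of computable $H,K$. Completion: for a represented space $(Y,\delta_Y)$, $\overline Y:=Y\cup\{\bot\}$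 with $\bot\notin Y$, represented by the total map $\delta_{\overline Y}:\mathbb N^{\mathbb N}\to\overline Y$ with $\delta_{\overline Y}(p)=\delta_Y(p-1)$ if $p-1\in\mathrm{dom}(\delta_Y)$ and $\delta_{\overline Y}(p)=\bot$ otherwise. Here $p-1\in\mathbb N^{\mathbb N}\cup\mathbb N^*$ is the finite or infinite sequence obtained by concatenating $p(0)-1,p(1)-1,\dots$, where $0-1$ is the empty word. The sequence space $X^{\mathbb N}$ is represented by $\langle p_0,p_1,\dots\rangle\mapsto(\delta_X(p_n))_n$, where $\langle p_0,p_1,\dots\rangle\langle n,k\rangle:=p_n(k)$ and $\langle n,k\rangle:=\frac12(n+k)(n+k+1)+k$ for $n,k\in\mathbb N$. Stashing: for $f:\subseteq X\rightrightarrows Y$, $\Sigma f:\subseteq X^{\mathbb N}\rightrightarrows\overline Y^{\mathbb N}$ has $\mathrm{dom}(\Sigma f)=\mathrm{dom}(f)^{\mathbb N}$ and $\Sigma f((x_n)_n)=\{(y_n)_n\in\overline Y^{\mathbb N}:(\exists n)\ y_n\in f(x_n)\}$. -}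

module Defs where

open import Level using (Level; _⊔_; 0ℓ) renaming (suc to lsuc)
open import Data.Empty using (⊥-elim)
open import Data.Fin using (Fin)
open import Data.List using (List; []; _∷_; _++_; [_]; length; concatMap; applyUpTo)
open import Data.List.Properties using (length-++; length-applyUpTo; ++-identityʳ; concatMap-++; ∷-injective)
open import Data.Maybe using (Maybe; just; nothing)
open import Data.Maybe.Relation.Binary.Pointwise as Maybe using (just; nothing)
open import Data.Nat using (ℕ; zero; suc; _+_; _*_; _<_; _≤_; _≡ᵇ_)
open import Data.Nat.DivMod using (_/_; _%_; m*n/n≡m; +-distrib-/-∣ʳ)
open import Data.Nat.Divisibility using (n∣m*n)
open import Data.Nat.Properties
  using (+-comm; +-identityʳ; +-suc; m≤n⇒∃[o]m+o≡n; ≤-total; +-cancelˡ-≡; suc-injective)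
open import Data.Nat.Solver using (module +-*-Solver)
open import Data.Bool using (if_then_else_)
open import Data.Product using (∃; ∃₂; ∃-syntax; _×_; _,_; proj₁; proj₂; uncurry)
open import Data.Sum using (inj₁; inj₂)
open import Data.Vec using (Vec; []; _∷_; lookup)
open import Function using (_∘_)
open import Relation.Binary using (Setoid; Rel; REL; _Respectsˡ_; _Respectsʳ_)
open import Relation.Binary.PropositionalEquality
  using (_≡_; _≗_; refl; sym; trans; cong; cong₂; subst; _→-setoid_; module ≡-Reasoning)
open import Relation.Nullary using (¬_; contradiction)

private variable
  a b c d ℓ : Level

-- Set-theoretic equality is rendered by setoid equality throughout, so
-- everything below has to respect it.

record PartialFunction (A : Setoid a b) (B : Setoid c d) (ℓ : Level) :
                       Set (a ⊔ b ⊔ c ⊔ d ⊔ lsuc ℓ) where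
  private
    module A = Setoid A
    module B = Setoid B
  field
    Graph      : REL A.Carrier B.Carrier ℓ
    respˡ      : Graph Respectsˡ A._≈_
    respʳ      : Graph Respectsʳ B._≈_
    functional : ∀ {x y y′} → Graph x y → Graph x y′ → y B.≈ y′

open PartialFunction using (Graph)

Baire : Set
Baire = ℕ → ℕ

BaireSetoid : Setoid 0ℓ 0ℓ
BaireSetoid = ℕ →-setoid ℕ

BairePartial : (ℓ : Level) → Set (lsuc ℓ)
BairePartial ℓ = PartialFunction BaireSetoid BaireSetoid ℓ

infixr 9 _∘ᵖ_

_∘ᵖ_ : BairePartial ℓ → BairePartial ℓ → BairePartial ℓ
G ∘ᵖ F = record
  { Graph      = λ x z → ∃[ y ] F.Graph x y × G.Graph y z
  ; respˡ      = λ { x≈x′ (y , Fxy , Gyz) → y , F.respˡ x≈x′ Fxy , Gyz }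
  ; respʳ      = λ { z≈z′ (y , Fxy , Gyz) → y , Fxy , G.respʳ z≈z′ Gyz }
  ; functional = λ { (y , Fxy , Gyz) (y′ , Fxy′ , Gy′z′) →
                     G.functional (G.respˡ (F.functional Fxy Fxy′) Gyz) Gy′z′ }
  }
  where
  module F = PartialFunction F
  module G = PartialFunction G

⟨_,_⟩ : Baire → Baire → Baire
⟨ p , q ⟩ m = if m % 2 ≡ᵇ 0 then p (m / 2) else q (m / 2)

private
  ⟨,⟩-cong : ∀ {p p′ q q′ : Baire} → p ≗ p′ → q ≗ q′ → ⟨ p , q ⟩ ≗ ⟨ p′ , q′ ⟩
  ⟨,⟩-cong p≗p′ q≗q′ m =
    cong₂ (if m % 2 ≡ᵇ 0 then_else_) (p≗p′ (m / 2)) (q≗q′ (m / 2))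

⟨id,_⟩ : BairePartial ℓ → BairePartial ℓ
⟨id, F ⟩ = record
  { Graph      = λ p r → ∃[ q ] F.Graph p q × r ≗ ⟨ p , q ⟩
  ; respˡ      = λ { {_} {p} {p′} p≗p′ (q , Fpq , r≗) → q , F.respˡ p≗p′ Fpq ,
                     λ m → trans (r≗ m) (⟨,⟩-cong {p} {p′} {q} {q} p≗p′ (λ _ → refl) m) }
  ; respʳ      = λ { r≗r′ (q , Fpq , r≗) → q , Fpq ,
                     λ m → trans (sym (r≗r′ m)) (r≗ m) }
  ; functional = λ { {p} (q , Fpq , r≗) (q′ , Fpq′ , r′≗) m →
                     trans (r≗ m)
                       (trans (⟨,⟩-cong {p} {p} {q} {q′} (λ _ → refl) (F.functional Fpq Fpq′) m)
                         (sym (r′≗ m))) }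
  }
  where module F = PartialFunction F

pair : ℕ → ℕ → ℕ
pair n k = (n + k) * (n + k + 1) / 2 + k

unpair : ℕ → ℕ × ℕ
unpair zero = 0 , 0
unpair (suc m) with unpair m
... | zero  , k = suc k , 0
... | suc n , k = n , suc k

private
  triangle-suc : ∀ s → suc s * (suc s + 1) / 2 ≡ s * (s + 1) / 2 + suc s
  triangle-suc s = begin
    suc s * (suc s + 1) / 2             ≡⟨ cong (_/ 2) (lemma s) ⟩
    (s * (s + 1) + suc s * 2) / 2       ≡⟨ +-distrib-/-∣ʳ (s * (s + 1)) (n∣m*n (suc s)) ⟩
    s * (s + 1) / 2 + suc s * 2 / 2     ≡⟨ cong (s * (s + 1) / 2 +_) (m*n/n≡m (suc s) 2) ⟩
    s * (s + 1) / 2 + suc s             ∎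
    where
    open ≡-Reasoning
    open +-*-Solver
    lemma : ∀ s → suc s * (suc s + 1) ≡ s * (s + 1) + suc s * 2
    lemma = solve 1 (λ s → (con 1 :+ s) :* (con 1 :+ s :+ con 1)
                           := s :* (s :+ con 1) :+ (con 1 :+ s) :* con 2) refl

  pair-zero : ∀ k → pair (suc k) 0 ≡ suc (pair 0 k)
  pair-zero k = begin
    pair (suc k) 0                            ≡⟨ +-identityʳ _ ⟩
    (suc k + 0) * (suc k + 0 + 1) / 2         ≡⟨ cong (λ s → s * (s + 1) / 2) (+-identityʳ (suc k)) ⟩
    suc k * (suc k + 1) / 2                   ≡⟨ triangle-suc k ⟩
    k * (k + 1) / 2 + suc k                   ≡⟨ +-suc _ k ⟩
    suc (pair 0 k)                            ∎
    where open ≡-Reasoning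

  pair-suc : ∀ n k → pair n (suc k) ≡ suc (pair (suc n) k)
  pair-suc n k = begin
    pair n (suc k)                                  ≡⟨ cong (λ s → s * (s + 1) / 2 + suc k) (+-suc n k) ⟩
    suc (n + k) * (suc (n + k) + 1) / 2 + suc k     ≡⟨ +-suc _ k ⟩
    suc (pair (suc n) k)                            ∎
    where open ≡-Reasoning

pair-unpair : ∀ m → uncurry pair (unpair m) ≡ m
pair-unpair zero = refl
pair-unpair (suc m) with unpair m | pair-unpair m
... | zero  , k | eq = trans (pair-zero k) (cong suc eq)
... | suc n , k | eq = trans (pair-suc n k) (cong suc eq)

private
  unpair-pair′ : ∀ m n k → pair n k ≡ m → unpair m ≡ (n , k)
  unpair-pair′ zero zero zero eq = refl
  unpair-pair′ zero (suc n) zero eq with trans (sym (pair-zero n)) eq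
  ... | ()
  unpair-pair′ zero n (suc k) eq with trans (sym (pair-suc n k)) eq
  ... | ()
  unpair-pair′ (suc m) zero zero ()
  unpair-pair′ (suc m) (suc n) zero eq
    rewrite unpair-pair′ m 0 n (suc-injective (trans (sym (pair-zero n)) eq)) = refl
  unpair-pair′ (suc m) n (suc k) eq
    rewrite unpair-pair′ m (suc n) k (suc-injective (trans (sym (pair-suc n k)) eq)) = refl

unpair-pair : ∀ n k → unpair (pair n k) ≡ (n , k)
unpair-pair n k = unpair-pair′ (pair n k) n k refl

-- component ⟨p₀,p₁,…⟩ n = pₙ; tuple p = ⟨p₀,p₁,…⟩.

component : Baire → ℕ → Baire
component p n k = p (pair n k)

tuple : (ℕ → Baire) → Baire
tuple p m = uncurry p (unpair m)

component-tuple : ∀ p n → component (tuple p) n ≗ p n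
component-tuple p n k = cong (uncurry p) (unpair-pair n k)

-- Partial recursive functions ℕᵏ ⇀ ℕ relative to an oracle in Baire
-- space; p ⊢ e [ xs ]⇓ y means that e with oracle p halts on xs with
-- output y.

data Code : ℕ → Set where
  zeroᶜ   : Code 0
  sucᶜ    : Code 1
  oracleᶜ : Code 1
  projᶜ   : ∀ {k} → Fin k → Code k
  compᶜ   : ∀ {k l} → Code l → Vec (Code k) l → Code k
  precᶜ   : ∀ {k} → Code k → Code (2 + k) → Code (1 + k)
  muᶜ     : ∀ {k} → Code (1 + k) → Code k

mutual
  data _⊢_[_]⇓_ (p : Baire) : ∀ {k} → Code k → Vec ℕ k → ℕ → Set where
    ⇓zero      : p ⊢ zeroᶜ [ [] ]⇓ 0
    ⇓suc       : ∀ {x} → p ⊢ sucᶜ [ x ∷ [] ]⇓ suc x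
    ⇓oracle    : ∀ {x} → p ⊢ oracleᶜ [ x ∷ [] ]⇓ p x
    ⇓proj      : ∀ {k} {i : Fin k} {xs} → p ⊢ projᶜ i [ xs ]⇓ lookup xs i
    ⇓comp      : ∀ {k l} {f : Code l} {gs : Vec (Code k) l} {xs ys z} →
                 p ⊢ gs [ xs ]⇓* ys → p ⊢ f [ ys ]⇓ z →
                 p ⊢ compᶜ f gs [ xs ]⇓ z
    ⇓prec-zero : ∀ {k} {f : Code k} {g xs y} →
                 p ⊢ f [ xs ]⇓ y →
                 p ⊢ precᶜ f g [ 0 ∷ xs ]⇓ y
    ⇓prec-suc  : ∀ {k} {f : Code k} {g xs n y z} →
                 p ⊢ precᶜ f g [ n ∷ xs ]⇓ y →
                 p ⊢ g [ n ∷ y ∷ xs ]⇓ z →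
                 p ⊢ precᶜ f g [ suc n ∷ xs ]⇓ z
    ⇓mu        : ∀ {k} {f : Code (1 + k)} {xs n} →
                 (∀ m → m < n → ∃[ y ] p ⊢ f [ m ∷ xs ]⇓ suc y) →
                 p ⊢ f [ n ∷ xs ]⇓ 0 →
                 p ⊢ muᶜ f [ xs ]⇓ n

  data _⊢_[_]⇓*_ (p : Baire) {k : ℕ} :
                 ∀ {l} → Vec (Code k) l → Vec ℕ k → Vec ℕ l → Set where
    []  : ∀ {xs} → p ⊢ [] [ xs ]⇓* []
    _∷_ : ∀ {l} {g : Code k} {gs : Vec (Code k) l} {xs y ys} →
          p ⊢ g [ xs ]⇓ y → p ⊢ gs [ xs ]⇓* ys →
          p ⊢ (g ∷ gs) [ xs ]⇓* (y ∷ ys)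

-- As usual for partial functions on Baire space, nothing is required of
-- the algorithm outside the domain of F.

Computable : BairePartial ℓ → Set ℓ
Computable F = ∃[ e ] (∀ {p q} → Graph F p q → ∀ n → p ⊢ e [ n ∷ [] ]⇓ q n)

Continuous : BairePartial ℓ → Set ℓ
Continuous F =
  ∀ {p q} → Graph F p q → ∀ n →
  ∃[ m ] (∀ {p′ q′} → Graph F p′ q′ →
          (∀ i → i < m → p i ≡ p′ i) → (∀ i → i < n → q i ≡ q′ i))

record RepresentedSpace (ℓ : Level) : Set (lsuc ℓ) where
  field
    space      : Setoid ℓ ℓ
    δ          : PartialFunction BaireSetoid space ℓ
    surjective : ∀ x → ∃[ p ] Graph δ p x
  open Setoid space public using (Carrier; _≈_)

open RepresentedSpace using (Carrier; δ)

-- R x y stands for y ∈ f(x), so that dom(f) = {x : f(x) ≠ ∅}.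

Realizes : (X Y : RepresentedSpace ℓ) → REL (Carrier X) (Carrier Y) ℓ →
           BairePartial ℓ → Set ℓ
Realizes X Y R F =
  ∀ {p x} → Graph (δ X) p x → ∃ (R x) →
  ∃[ q ] Graph F p q × (∃[ y ] Graph (δ Y) q y × R x y)

record Problem (ℓ : Level) : Set (lsuc ℓ) where
  field
    source target : RepresentedSpace ℓ
  private
    module X = RepresentedSpace source
    module Y = RepresentedSpace target
  field
    Solution : REL X.Carrier Y.Carrier ℓ
    respˡ    : Solution Respectsˡ X._≈_
    respʳ    : Solution Respectsʳ Y._≈_
    realizer : ∃ (Realizes source target Solution)

  dom : X.Carrier → Set ℓ
  dom x = ∃ (Solution x)

_IsRealizerOf_ : BairePartial ℓ → Problem ℓ → Set ℓ
F IsRealizerOf f = Realizes f.source f.target f.Solution F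
  where module f = Problem f

word : ℕ → List ℕ
word zero    = []
word (suc n) = [ n ]

-- p -1≡ q states that p - 1 is infinite and equal to q: every finite
-- prefix of q is (p(0)-1)(p(1)-1)…(p(k-1)-1) for some k.

_-1≡_ : Baire → Baire → Set
p -1≡ q = ∀ n → ∃[ k ] concatMap word (applyUpTo p k) ≡ applyUpTo q n

private
  applyUpTo-cong : ∀ (p q : Baire) → p ≗ q → ∀ n → applyUpTo p n ≡ applyUpTo q n
  applyUpTo-cong p q p≗q zero    = refl
  applyUpTo-cong p q p≗q (suc n) =
    cong₂ _∷_ (p≗q 0) (applyUpTo-cong (p ∘ suc) (q ∘ suc) (p≗q ∘ suc) n)

  applyUpTo-+ : ∀ (p : Baire) k j →
                applyUpTo p (k + j) ≡ applyUpTo p k ++ applyUpTo (p ∘ (k +_)) j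
  applyUpTo-+ p zero    j = refl
  applyUpTo-+ p (suc k) j = cong (p 0 ∷_) (applyUpTo-+ (p ∘ suc) k j)

  applyUpTo-last : ∀ (p q : Baire) n → applyUpTo p (suc n) ≡ applyUpTo q (suc n) → p n ≡ q n
  applyUpTo-last p q zero    eq = proj₁ (∷-injective eq)
  applyUpTo-last p q (suc n) eq = applyUpTo-last (p ∘ suc) (q ∘ suc) n (proj₂ (∷-injective eq))

  length-0 : ∀ (xs : List ℕ) → length xs ≡ 0 → xs ≡ []
  length-0 [] _ = refl

  prefix-unique : ∀ (p q q′ : Baire) n {k k′} → k ≤ k′ →
                  concatMap word (applyUpTo p k)  ≡ applyUpTo q n →
                  concatMap word (applyUpTo p k′) ≡ applyUpTo q′ n →
                  applyUpTo q n ≡ applyUpTo q′ n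
  prefix-unique p q q′ n {k} k≤k′ eq eq′ with j , refl ← m≤n⇒∃[o]m+o≡n k≤k′ =
    trans (sym (++-identityʳ _)) (trans (cong (applyUpTo q n ++_) (sym rest≡[])) split)
    where
    open ≡-Reasoning
    rest : List ℕ
    rest = concatMap word (applyUpTo (p ∘ (k +_)) j)
    split : applyUpTo q n ++ rest ≡ applyUpTo q′ n
    split = begin
      applyUpTo q n ++ rest                                       ≡⟨ cong (_++ rest) (sym eq) ⟩
      concatMap word (applyUpTo p k) ++ rest                      ≡⟨ concatMap-++ word (applyUpTo p k) _ ⟨
      concatMap word (applyUpTo p k ++ applyUpTo (p ∘ (k +_)) j)  ≡⟨ cong (concatMap word) (applyUpTo-+ p k j) ⟨
      concatMap word (applyUpTo p (k + j))                        ≡⟨ eq′ ⟩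
      applyUpTo q′ n                                              ∎
    rest≡[] : rest ≡ []
    rest≡[] = length-0 rest (+-cancelˡ-≡ n _ _ (begin
      n + length rest                        ≡⟨ cong (_+ length rest) (length-applyUpTo q n) ⟨
      length (applyUpTo q n) + length rest   ≡⟨ length-++ (applyUpTo q n) ⟨
      length (applyUpTo q n ++ rest)         ≡⟨ cong length split ⟩
      length (applyUpTo q′ n)                ≡⟨ length-applyUpTo q′ n ⟩
      n                                      ≡⟨ +-identityʳ n ⟨
      n + 0                                  ∎))

-1≡-respˡ : ∀ {p p′ q} → p ≗ p′ → p -1≡ q → p′ -1≡ q
-1≡-respˡ {p} {p′} p≗p′ p-1 n with k , eq ← p-1 n =
  k , trans (cong (concatMap word) (sym (applyUpTo-cong p p′ p≗p′ k))) eq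

-1≡-functional : ∀ {p q q′} → p -1≡ q → p -1≡ q′ → q ≗ q′
-1≡-functional {p} {q} {q′} h h′ n with h (suc n) | h′ (suc n)
... | k , eq | k′ , eq′ with ≤-total k k′
...   | inj₁ k≤k′ = applyUpTo-last q q′ n (prefix-unique p q q′ (suc n) k≤k′ eq eq′)
...   | inj₂ k′≤k = applyUpTo-last q q′ n (sym (prefix-unique p q′ q (suc n) k′≤k eq′ eq))

suc-1≡ : ∀ q → (suc ∘ q) -1≡ q
suc-1≡ q n = n , lemma q n
  where
  lemma : ∀ q n → concatMap word (applyUpTo (suc ∘ q) n) ≡ applyUpTo q n
  lemma q zero    = refl
  lemma q (suc n) = cong (q 0 ∷_) (lemma (q ∘ suc) n)

private
  0≢-1 : ∀ {q} → ¬ ((λ _ → 0) -1≡ q)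
  0≢-1 h with h 1
  ... | k , eq = contradiction (trans (sym (lemma k)) eq) λ ()
    where
    lemma : ∀ k → concatMap word (applyUpTo (λ _ → 0) k) ≡ []
    lemma zero    = refl
    lemma (suc k) = lemma k

-- just y is y ∈ Y and nothing is ⊥.  Totality of the representation is
-- classical: it needs a decision whether p - 1 ∈ dom(δ).

completion : RepresentedSpace ℓ → RepresentedSpace ℓ
completion {ℓ} Y = record
  { space      = Maybe.setoid Y.space
  ; δ          = record
    { Graph      = Graph̅
    ; respˡ      = λ {y} → respˡ̅ y
    ; respʳ      = respʳ̅
    ; functional = functional̅
    }
  ; surjective = surjective̅
  }
  where
  module Y = RepresentedSpace Y
  module δY = PartialFunction Y.δ

  Graph̅ : REL Baire (Maybe Y.Carrier) ℓ
  Graph̅ p (just y) = ∃[ q ] p -1≡ q × δY.Graph q y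
  Graph̅ p nothing  = ¬ (∃₂ λ q y → p -1≡ q × δY.Graph q y)

  respˡ̅ : ∀ y {p p′} → p ≗ p′ → Graph̅ p y → Graph̅ p′ y
  respˡ̅ (just y) p≗p′ (q , p-1 , δqy) = q , -1≡-respˡ p≗p′ p-1 , δqy
  respˡ̅ nothing  p≗p′ h (q , y , p-1 , δqy) =
    h (q , y , -1≡-respˡ (λ n → sym (p≗p′ n)) p-1 , δqy)

  respʳ̅ : ∀ {p y y′} → Maybe.Pointwise Y._≈_ y y′ → Graph̅ p y → Graph̅ p y′
  respʳ̅ (just y≈y′) (q , p-1 , δqy) = q , p-1 , δY.respʳ y≈y′ δqy
  respʳ̅ nothing     h               = h

  functional̅ : ∀ {p y y′} → Graph̅ p y → Graph̅ p y′ → Maybe.Pointwise Y._≈_ y y′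
  functional̅ {y = just _}  {just _}  (q , p-1 , δqy) (q′ , p-1′ , δq′y′) =
    just (δY.functional (δY.respˡ (-1≡-functional p-1 p-1′) δqy) δq′y′)
  functional̅ {y = just y}  {nothing} (q , p-1 , δqy) h = ⊥-elim (h (q , y , p-1 , δqy))
  functional̅ {y = nothing} {just y}  h (q , p-1 , δqy) = ⊥-elim (h (q , y , p-1 , δqy))
  functional̅ {y = nothing} {nothing} _ _ = nothing

  surjective̅ : ∀ y → ∃[ p ] Graph̅ p y
  surjective̅ (just y) with q , δqy ← Y.surjective y = suc ∘ q , q , suc-1≡ q , δqy
  surjective̅ nothing  = (λ _ → 0) , λ { (q , y , p-1 , _) → 0≢-1 p-1 }

sequences : RepresentedSpace ℓ → RepresentedSpace ℓ
sequences X = record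
  { space      = record
    { Carrier       = ℕ → X.Carrier
    ; _≈_           = λ x x′ → ∀ n → x n X.≈ x′ n
    ; isEquivalence = record
      { refl  = λ n → S.refl
      ; sym   = λ x≈y n → S.sym (x≈y n)
      ; trans = λ x≈y y≈z n → S.trans (x≈y n) (y≈z n)
      }
    }
  ; δ          = record
    { Graph      = λ p x → ∀ n → δX.Graph (component p n) (x n)
    ; respˡ      = λ p≗p′ h n → δX.respˡ (λ k → p≗p′ (pair n k)) (h n)
    ; respʳ      = λ x≈x′ h n → δX.respʳ (x≈x′ n) (h n)
    ; functional = λ h h′ n → δX.functional (h n) (h′ n)
    }
  ; surjective = λ x → tuple (λ n → proj₁ (X.surjective (x n))) , λ n →
      δX.respˡ (λ k → sym (component-tuple (λ n → proj₁ (X.surjective (x n))) n k))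
               (proj₂ (X.surjective (x n)))
  }
  where
  module X = RepresentedSpace X
  module S = Setoid X.space
  module δX = PartialFunction X.δ

-- The first conjunct of Solution restricts the domain to dom(f)^ℕ.

stash : Problem ℓ → Problem ℓ
stash {ℓ} f = record
  { source   = sequences f.source
  ; target   = sequences (completion f.target)
  ; Solution = ΣSolution
  ; respˡ    = λ { x≈x′ (dom , n , y , yₙ≈ , r) →
                 (λ m → proj₁ (dom m) , f.respˡ (x≈x′ m) (proj₂ (dom m))) ,
                 n , y , yₙ≈ , f.respˡ (x≈x′ n) r }
  ; respʳ    = λ { y≈y′ (dom , n , y , yₙ≈ , r) →
                 dom , n , y , S.trans (S.sym (y≈y′ n)) yₙ≈ , r }
  ; realizer = ΣF , λ {p} {x} → realizes p x
  }
  where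
  module f = Problem f
  module X = RepresentedSpace f.source
  module Y = RepresentedSpace f.target
  module δX = PartialFunction X.δ
  module δY = PartialFunction Y.δ
  module F = PartialFunction (proj₁ f.realizer)
  Y̅ : RepresentedSpace ℓ
  Y̅ = completion f.target
  module Y̅ = RepresentedSpace Y̅
  module S = Setoid Y̅.space
  module δY̅ = PartialFunction Y̅.δ

  ΣSolution : REL (ℕ → X.Carrier) (ℕ → Y̅.Carrier) ℓ
  ΣSolution x y = (∀ n → f.dom (x n)) × (∃[ n ] ∃[ z ] y n Y̅.≈ just z × f.Solution (x n) z)

  ΣF : BairePartial ℓ
  ΣF = record
    { Graph      = λ p r → ∀ n → ∃[ q ] F.Graph (component p n) q × component r n ≗ suc ∘ q
    ; respˡ      = λ { {_} {p} {p′} p≗p′ h n → let q , Fq , r≗ = h n in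
                       q , F.respˡ (λ k → p≗p′ (pair n k)) Fq , r≗ }
    ; respʳ      = λ { {_} {r} {r′} r≗r′ h n → let q , Fq , r≗ = h n in
                       q , Fq , λ k → trans (sym (r≗r′ (pair n k))) (r≗ k) }
    ; functional = λ {p} {r} {r′} h h′ m →
        let n , k = unpair m
            q  , Fq  , r≗  = h n
            q′ , Fq′ , r′≗ = h′ n
        in subst (λ i → r i ≡ r′ i) (pair-unpair m)
             (trans (r≗ k) (trans (cong suc (F.functional Fq Fq′ k)) (sym (r′≗ k))))
    }

  realizes : ∀ p x → (∀ n → δX.Graph (component p n) (x n)) → ∃ (ΣSolution x) →
             ∃[ r ] PartialFunction.Graph ΣF p r ×
             (∃[ y ] (∀ n → δY̅.Graph (component r n) (y n)) × ΣSolution x y)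
  realizes p x names (_ , dom , _) =
    tuple r , graph , y , named , dom , 0 , proj₁ (out 0) , S.refl , proj₂ (proj₂ (out 0))
    where
    step : ∀ n → ∃[ q ] F.Graph (component p n) q × (∃[ z ] δY.Graph q z × f.Solution (x n) z)
    step n = proj₂ f.realizer (names n) (dom n)
    out : ∀ n → ∃[ z ] δY.Graph (proj₁ (step n)) z × f.Solution (x n) z
    out n = proj₂ (proj₂ (step n))
    r : ℕ → Baire
    r n = suc ∘ proj₁ (step n)
    y : ℕ → Y̅.Carrier
    y n = just (proj₁ (out n))
    graph : ∀ n → ∃[ q ] F.Graph (component p n) q × component (tuple r) n ≗ suc ∘ q
    graph n = proj₁ (step n) , proj₁ (proj₂ (step n)) , component-tuple r n
    named : ∀ n → δY̅.Graph (component (tuple r) n) (y n)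
    named n = δY̅.respˡ {y n} (λ k → sym (component-tuple r n k))
                (proj₁ (step n) , suc-1≡ _ , proj₁ (proj₂ (out n)))

module Reducibility {ℓ} (Admissible : BairePartial ℓ → Set ℓ) where

  Reduces StronglyReduces : Rel (Problem ℓ) (lsuc ℓ)

  Reduces f g =
    ∃₂ λ (H K : BairePartial ℓ) → Admissible H × Admissible K ×
    (∀ G → G IsRealizerOf g → (H ∘ᵖ ⟨id, G ∘ᵖ K ⟩) IsRealizerOf f)

  StronglyReduces f g =
    ∃₂ λ (H K : BairePartial ℓ) → Admissible H × Admissible K ×
    (∀ G → G IsRealizerOf g → (H ∘ᵖ G ∘ᵖ K) IsRealizerOf f)

infix 4 _≤W_ _≤sW_ _≤W*_ _≤sW*_

_≤W_ _≤sW_ _≤W*_ _≤sW*_ : Rel (Problem ℓ) (lsuc ℓ)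
_≤W_   = Reducibility.Reduces Computable
_≤sW_  = Reducibility.StronglyReduces Computable
_≤W*_  = Reducibility.Reduces Continuous
_≤sW*_ = Reducibility.StronglyReduces Continuous

IsInteriorOperator : Rel (Problem ℓ) (lsuc ℓ) → (Problem ℓ → Problem ℓ) → Set (lsuc ℓ)
IsInteriorOperator _≤_ I =
  (∀ f → I f ≤ f) ×
  (∀ f g → f ≤ g → I f ≤ I g) ×
  (∀ f → I f ≤ I (I f))

{-# OPTIONS --safe #-}

-- Reductions are first rephrased without realizers: by excluded middle, a
-- realizer of g can be redirected at a single name, so f ≤ g via H and K
-- says that K maps names of instances to names of instances, and that H
-- maps the name of any single solution back to a name of a solution.
--
-- Σf ≤ f: look at instance 0 and repeat its solution.  Σf ≤ ΣΣf: arrange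
-- the instances in a double sequence along the pairing function; p - 1
-- applied twice just removes more blanks.  Monotonicity: K is applied
-- componentwise.  The components of the solution may be undefined, so H
-- has to be run on partial oracles: every computable or continuous H has
-- stagewise approximations that only use the digits of r - 1 known at
-- that stage, and outputting blanks while waiting for the next digit
-- makes the result a total name in the completion.
--
-- The computable and the continuous case are treated uniformly through
-- classes of total functionals closed under primitive recursion and
-- substitution for the oracle.

module Submission where

open import Defs
open import Axiom.ExcludedMiddle using (ExcludedMiddle)
open import Data.Fin using (Fin; zero; suc; _↑ˡ_; _↑ʳ_)
open import Data.List as List using (List; []; _∷_; _∷ʳ_; [_]; length; concatMap; applyUpTo)
open import Data.List.Properties using (applyUpTo-∷ʳ; ∷ʳ-injective; concatMap-++; length-++; ++-identityʳ)
open import Data.Maybe using (just; nothing)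
open import Data.Nat hiding (parity)
open import Data.Nat.DivMod
open import Data.Nat.Divisibility using (n∣m*n)
open import Data.Nat.Properties
open import Data.Nat.Solver using (module +-*-Solver)
open import Data.Product using (∃; ∃₂; ∃-syntax; Σ-syntax; _×_; _,_; proj₁; proj₂)
open import Data.Sum using (_⊎_; inj₁; inj₂)
open import Data.Vec using (Vec; []; _∷_; _++_; lookup; map; take; drop; tabulate; head; tail)
open import Data.Vec.Properties
  using (lookup-++ˡ; lookup-++ʳ; tabulate-cong; tabulate∘lookup; take++drop≡id)
open import Data.Vec.Relation.Unary.All using (All; []; _∷_)
open import Function using (_∘_; id; case_of_)
open import Level using (Level; Lift; lift) renaming (suc to lsuc)
open import Relation.Binary using (Setoid)
open import Relation.Binary.Definitions using (tri<; tri≈; tri>)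
open import Relation.Binary.PropositionalEquality
  using (_≡_; _≗_; refl; sym; trans; cong; cong₂; subst; module ≡-Reasoning)
open import Relation.Nullary using (¬_; Dec; yes; no; contradiction)

open PartialFunction using (Graph)

private variable
  ℓ : Level
  k l c : ℕ

-- Pairing, unpairing and halving by primitive recursion on numbers.

ifz : ℕ → ℕ → ℕ → ℕ
ifz zero    a b = a
ifz (suc _) a b = b

primrec : ℕ → (ℕ → ℕ → ℕ) → ℕ → ℕ
primrec z s zero    = z
primrec z s (suc n) = s n (primrec z s n)

triangle : ℕ → ℕ
triangle = primrec 0 (λ s y → y + suc s)

pair-triangle : ∀ n k → triangle (n + k) + k ≡ pair n k
pair-triangle n k = cong (_+ k) (begin
  triangle (n + k)                 ≡⟨ m*n/n≡m (triangle (n + k)) 2 ⟨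
  triangle (n + k) * 2 / 2         ≡⟨ cong (_/ 2) (twice (n + k)) ⟩
  (n + k) * (n + k + 1) / 2        ∎)
  where
  open ≡-Reasoning
  open +-*-Solver
  step : ∀ s → s * (s + 1) + suc s * 2 ≡ suc s * (suc s + 1)
  step = solve 1 (λ s → s :* (s :+ con 1) :+ (con 1 :+ s) :* con 2
                        := (con 1 :+ s) :* (con 1 :+ s :+ con 1)) refl
  twice : ∀ s → triangle s * 2 ≡ s * (s + 1)
  twice zero    = refl
  twice (suc s) = trans (*-distribʳ-+ 2 (triangle s) (suc s))
                    (trans (cong (_+ suc s * 2) (twice s)) (step s))

-- For m = ⟨n,k⟩ on the diagonal s = n + k, the truncated difference
-- s ∸ (m ∸ triangle s) is n, which is 0 at the end of the diagonal.

diagonal : ℕ → ℕ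
diagonal = primrec 0 (λ m s → ifz (s ∸ (m ∸ triangle s)) (suc s) s)

-- The two claims support each other: `diagonal` detects the end of a diagonal by recovering the
-- first coordinate from the offset, and the offset is known once the diagonal is.
unpair-diagonal : ∀ m → diagonal m ≡ proj₁ (unpair m) + proj₂ (unpair m) ×
                        m ∸ triangle (diagonal m) ≡ proj₂ (unpair m)
unpair-diagonal zero    = refl , refl
unpair-diagonal (suc m) = diag , offset (suc m) diag
  where
  offset : ∀ m → diagonal m ≡ proj₁ (unpair m) + proj₂ (unpair m) →
           m ∸ triangle (diagonal m) ≡ proj₂ (unpair m)
  offset m eq with unpair m | pair-unpair m
  ... | n , k | refl =
    trans (cong₂ _∸_ (sym (pair-triangle n k)) (cong triangle eq)) (m+n∸m≡n (triangle (n + k)) k)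
  diag : diagonal (suc m) ≡ proj₁ (unpair (suc m)) + proj₂ (unpair (suc m))
  diag with unpair m | unpair-diagonal m
  ... | zero , k | eq , eq′ rewrite eq′ | eq | n∸n≡0 k = cong suc (sym (+-identityʳ k))
  ... | suc n , k | eq , eq′ rewrite eq′ | eq | m+n∸n≡m (suc n) k = sym (+-suc n k)

unpair₁ unpair₂ : ℕ → ℕ
unpair₁ m = diagonal m ∸ (m ∸ triangle (diagonal m))
unpair₂ m = m ∸ triangle (diagonal m)

unpair₂-correct : ∀ m → unpair₂ m ≡ proj₂ (unpair m)
unpair₂-correct m = proj₂ (unpair-diagonal m)

unpair₁-correct : ∀ m → unpair₁ m ≡ proj₁ (unpair m)
unpair₁-correct m =
  trans (cong₂ _∸_ (proj₁ (unpair-diagonal m)) (proj₂ (unpair-diagonal m)))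
        (m+n∸n≡m (proj₁ (unpair m)) (proj₂ (unpair m)))

parity half : ℕ → ℕ
parity = primrec 0 (λ _ y → 1 ∸ y)
half   = primrec 0 (λ n y → y + parity n)

parity-01 : ∀ n → parity n ≡ 0 ⊎ parity n ≡ 1
parity-01 zero = inj₁ refl
parity-01 (suc n) with parity n | parity-01 n
... | _ | inj₁ refl = inj₂ refl
... | _ | inj₂ refl = inj₁ refl

parity+half*2 : ∀ n → parity n + half n * 2 ≡ n
parity+half*2 zero = refl
parity+half*2 (suc n) with parity n | parity-01 n | half n | parity+half*2 n
... | _ | inj₁ refl | h | eq rewrite +-identityʳ h = cong suc eq
... | _ | inj₂ refl | h | eq rewrite +-comm h 1 = cong suc eq

parity-% : ∀ n → parity n ≡ n % 2
parity-% n = begin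
  parity n                        ≡⟨ small (parity-01 n) ⟨
  parity n % 2                    ≡⟨ [m+kn]%n≡m%n (parity n) (half n) 2 ⟨
  (parity n + half n * 2) % 2     ≡⟨ cong (_% 2) (parity+half*2 n) ⟩
  n % 2                           ∎
  where
  open ≡-Reasoning
  small : ∀ {m} → m ≡ 0 ⊎ m ≡ 1 → m % 2 ≡ m
  small (inj₁ refl) = refl
  small (inj₂ refl) = refl

half-/ : ∀ n → half n ≡ n / 2
half-/ n = begin
  half n                          ≡⟨ cong₂ _+_ (small (parity-01 n)) (m*n/n≡m (half n) 2) ⟨
  parity n / 2 + half n * 2 / 2   ≡⟨ +-distrib-/-∣ʳ (parity n) (n∣m*n (half n)) ⟨
  (parity n + half n * 2) / 2     ≡⟨ cong (_/ 2) (parity+half*2 n) ⟩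
  n / 2                           ∎
  where
  open ≡-Reasoning
  small : ∀ {m} → m ≡ 0 ⊎ m ≡ 1 → m / 2 ≡ 0
  small (inj₁ refl) = refl
  small (inj₂ refl) = refl

⟨,⟩-ifz : ∀ p q m → ifz (parity m) (p (half m)) (q (half m)) ≡ ⟨ p , q ⟩ m
⟨,⟩-ifz p q m rewrite half-/ m | sym (parity-% m) with parity m
... | zero  = refl
... | suc _ = refl

⟨,⟩-even : ∀ p q n → ⟨ p , q ⟩ (n + n) ≡ p n
⟨,⟩-even p q n rewrite trans (cong (n +_) (sym (+-identityʳ n))) (*-comm 2 n)
  | m*n%n≡0 n 2 ⦃ _ ⦄ | m*n/n≡m n 2 ⦃ _ ⦄ = refl

⟨,⟩-odd : ∀ p q n → ⟨ p , q ⟩ (suc (n + n)) ≡ q n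
⟨,⟩-odd p q n rewrite trans (cong (n +_) (sym (+-identityʳ n))) (*-comm 2 n)
  | [m+kn]%n≡m%n 1 n 2 ⦃ _ ⦄ | +-distrib-/-∣ʳ 1 {d = 2} ⦃ _ ⦄ (n∣m*n n) | m*n/n≡m n 2 ⦃ _ ⦄ = refl

-- Values and sequences approximated in stages.

-- A stagewise approximation: 0 stands for "no value yet".

infix 4 _⇝_

_⇝_ : Baire → ℕ → Set
a ⇝ y = (∀ t → a t ≡ 0 ⊎ a t ≡ suc y) × ∃[ T ] (∀ t → T ≤ t → a t ≡ suc y)

⇝-const : ∀ y → (λ _ → suc y) ⇝ y
⇝-const y = (λ _ → inj₂ refl) , 0 , λ _ _ → refl

⇝-cong : ∀ {a b y} → (∀ t → a t ≡ b t) → a ⇝ y → b ⇝ y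
⇝-cong a≗b (s , T , c) =
  (λ t → subst (λ v → v ≡ 0 ⊎ v ≡ suc _) (a≗b t) (s t)) , T , λ t T≤t → trans (sym (a≗b t)) (c t T≤t)

-- Strict sequencing: a non-zero `a t` is always `suc x`, so `b` is only run on the final value `x`
-- and has to be well-behaved for that `x` alone.
⇝-bind : ∀ {a x y} (b : ℕ → ℕ → ℕ) → a ⇝ x → (λ t → b t x) ⇝ y →
         (λ t → ifz (a t) 0 (b t (pred (a t)))) ⇝ y
⇝-bind {a} {x} {y} b (s , T , c) (s′ , T′ , c′) = sound , T ⊔ T′ , complete
  where
  sound : ∀ t → ifz (a t) 0 (b t (pred (a t))) ≡ 0 ⊎ ifz (a t) 0 (b t (pred (a t))) ≡ suc y
  sound t with a t | s t
  ... | _ | inj₁ refl = inj₁ refl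
  ... | _ | inj₂ refl = s′ t
  complete : ∀ t → T ⊔ T′ ≤ t → ifz (a t) 0 (b t (pred (a t))) ≡ suc y
  complete t le with a t | c t (≤-trans (m≤m⊔n T T′) le)
  ... | _ | refl = c′ t (≤-trans (m≤n⊔m T T′) le)

infix 4 _Approximates_

_Approximates_ : (ℕ → Baire) → Baire → Set
U Approximates p = ∀ i → (λ t → U t i) ⇝ p i

eventually-∀< : ∀ {Q : ℕ → ℕ → Set} n → (∀ i → i < n → ∃[ T ] (∀ t → T ≤ t → Q i t)) →
                ∃[ T ] (∀ t → T ≤ t → ∀ i → i < n → Q i t)
eventually-∀< zero    h = 0 , λ _ _ _ ()
eventually-∀< {Q} (suc n) h
  with T , c ← h 0 z<s | T′ , c′ ← eventually-∀< {Q ∘ suc} n (λ i i<n → h (suc i) (s<s i<n)) =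
  T ⊔ T′ , λ where
    t le zero    _   → c t (≤-trans (m≤m⊔n T T′) le)
    t le (suc i) i<n → c′ t (≤-trans (m≤n⊔m T T′) le) i (s<s⁻¹ i<n)

-- Reading and writing names with blanks.

produced : Baire → ℕ → ℕ
produced r = primrec 0 (λ t c → ifz (r t) c (suc c))

produced-mono : ∀ r {t t′} → t ≤ t′ → produced r t ≤ produced r t′
produced-mono r {t} t≤t′ with d , refl ← m≤n⇒∃[o]m+o≡n t≤t′ = go d
  where
  step : ∀ t → produced r t ≤ produced r (suc t)
  step t with r t
  ... | zero  = ≤-refl
  ... | suc _ = n≤1+n _
  go : ∀ d → produced r t ≤ produced r (t + d)
  go zero    = ≤-reflexive (cong (produced r) (sym (+-identityʳ t)))
  go (suc d) = ≤-trans (go d) (≤-trans (step (t + d)) (≤-reflexive (cong (produced r) (sym (+-suc t d)))))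

-- An entrywise form of `r -1≡ q`, to which it is equivalent if it holds at all `t` and `produced r`
-- reaches every number. Here `produced r t` is the length of the word decoded from the first `t`
-- entries.
Emits : Baire → Baire → ℕ → Set
Emits r q t = r t ≡ 0 ⊎ r t ≡ suc (q (produced r t))

private
  prefix-suc : ∀ r k → concatMap word (applyUpTo r (suc k)) ≡ concatMap word (applyUpTo r k) List.++ word (r k)
  prefix-suc r k = begin
    concatMap word (applyUpTo r (suc k))          ≡⟨ cong (concatMap word) (applyUpTo-∷ʳ r k) ⟨
    concatMap word (applyUpTo r k ∷ʳ r k)         ≡⟨ concatMap-++ word (applyUpTo r k) [ r k ] ⟩
    concatMap word (applyUpTo r k) List.++ (word (r k) List.++ [])
                                                  ≡⟨ cong (concatMap word (applyUpTo r k) List.++_) (++-identityʳ (word (r k))) ⟩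
    concatMap word (applyUpTo r k) List.++ word (r k)  ∎
    where open ≡-Reasoning

-- Induction on `k`, taking entries of `r` off the right end: a blank leaves the decoded word alone,
-- and any other entry contributes its last letter, which must be the last letter of the prefix of
-- `q`.
-1≡⇒Emits-< : ∀ r q k n → concatMap word (applyUpTo r k) ≡ applyUpTo q n →
              produced r k ≡ n × (∀ t → t < k → Emits r q t)
-1≡⇒Emits-< r q zero    zero    eq = refl , λ _ ()
-1≡⇒Emits-< r q (suc k) n       eq with r k in rk | trans (sym (prefix-suc r k)) eq
... | zero | eq′ = proj₁ IH , λ t t<sk → case m≤n⇒m<n∨m≡n (s≤s⁻¹ t<sk) of λ where
      (inj₁ t<k)  → proj₂ IH t t<k
      (inj₂ refl) → inj₁ rk
  where
  IH : produced r k ≡ n × (∀ t → t < k → Emits r q t)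
  IH = -1≡⇒Emits-< r q k n (trans (sym (++-identityʳ _)) eq′)
-1≡⇒Emits-< r q (suc k) zero    eq | suc v | eq′ = contradiction
  (trans (+-comm 1 _) (trans (sym (length-++ (concatMap word (applyUpTo r k)))) (cong length eq′))) λ ()
-1≡⇒Emits-< r q (suc k) (suc n) eq | suc v | eq′
  with eq″ , vq ← ∷ʳ-injective _ _ (trans eq′ (sym (applyUpTo-∷ʳ q n)))
  with refl , IH ← -1≡⇒Emits-< r q k n eq″ = refl , λ t t<sk → case m≤n⇒m<n∨m≡n (s≤s⁻¹ t<sk) of λ where
      (inj₁ t<k)  → IH t t<k
      (inj₂ refl) → inj₂ (trans rk (cong suc vq))

-- A prefix of `r` that decodes to one letter more than the first `t` entries do is longer than `t`,
-- because `produced` is monotone; the bounded version then covers `t`.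
-1≡⇒Emits : ∀ {r q} → r -1≡ q → ∀ t → Emits r q t
-1≡⇒Emits {r} {q} r-1 t with k , eq ← r-1 (suc (produced r t)) with ≤-total k t
... | inj₁ k≤t = contradiction (proj₁ (-1≡⇒Emits-< r q k _ eq))
                   (<⇒≢ (s≤s (produced-mono r k≤t)))
... | inj₂ t≤k with m≤n⇒m<n∨m≡n t≤k
...   | inj₁ t<k  = proj₂ (-1≡⇒Emits-< r q k _ eq) t t<k
...   | inj₂ refl = contradiction (proj₁ (-1≡⇒Emits-< r q k _ eq)) (<⇒≢ ≤-refl)

-1≡⇒produced : ∀ {r q} → r -1≡ q → ∀ n → ∃[ t ] produced r t ≡ n
-1≡⇒produced {r} {q} r-1 n with k , eq ← r-1 n = k , proj₁ (-1≡⇒Emits-< r q k n eq)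

Emits⇒-1≡ : ∀ {r q} → (∀ t → Emits r q t) → (∀ n → ∃[ t ] produced r t ≡ n) → r -1≡ q
Emits⇒-1≡ {r} {q} emits unbounded n with t , refl ← unbounded n = t , prefix t
  where
  prefix : ∀ t → concatMap word (applyUpTo r t) ≡ applyUpTo q (produced r t)
  prefix zero = refl
  prefix (suc t) with r t | emits t | prefix-suc r t
  ... | _ | inj₁ refl | eq = trans eq (trans (++-identityʳ _) (prefix t))
  ... | _ | inj₂ refl | eq = trans eq (trans (cong (List._++ [ q (produced r t) ]) (prefix t)) (applyUpTo-∷ʳ q _))

-- digit r t i is q(i) + 1 once the prefix of r of length t determines
-- the i-th entry q(i) of r - 1, and 0 before.

digit : Baire → ℕ → ℕ → ℕ
digit r t i =
  primrec 0 (λ s y → ifz (produced r (suc s) ∸ i) 0 (ifz (produced r s ∸ i) (r s) y)) t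

digit-approximates : ∀ {r q} → r -1≡ q → digit r Approximates q
digit-approximates {r} {q} r-1 i = sound , complete
  where
  -- `digit` records `r s` at the one stage `s` where the count goes from `i` to `i + 1`, and keeps
  -- this value from then on.
  invariant : ∀ t → (produced r t ≤ i × digit r t i ≡ 0) ⊎
                    (i < produced r t × digit r t i ≡ suc (q i))
  invariant zero = inj₁ (z≤n , refl)
  invariant (suc t) with produced r (suc t) ∸ i in eq
  ... | zero = inj₁ (m∸n≡0⇒m≤n eq , refl)
  ... | suc _ with produced r t ∸ i in eq′ | r t in rt | -1≡⇒Emits r-1 t
  ...   | zero | zero  | _ = contradiction (trans (sym eq) eq′) λ ()
  ...   | zero | suc v | inj₂ refl
    rewrite ≤-antisym (m∸n≡0⇒m≤n {produced r t} eq′)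
              (s≤s⁻¹ (m∸n≢0⇒n<m {suc (produced r t)} {i} λ e → contradiction (trans (sym eq) e) λ ())) =
    inj₂ (≤-refl , refl)
  ...   | suc _ | rt′ | _ with invariant t
  ...     | inj₁ (le , _) = contradiction (trans (sym eq′) (m≤n⇒m∸n≡0 le)) λ ()
  ...     | inj₂ (lt , e) = inj₂ (≤-trans lt (mono rt′) , e)
    where
    mono : ∀ v → produced r t ≤ ifz v (produced r t) (suc (produced r t))
    mono zero    = ≤-refl
    mono (suc _) = n≤1+n _
  sound : ∀ t → digit r t i ≡ 0 ⊎ digit r t i ≡ suc (q i)
  sound t with invariant t
  ... | inj₁ (_ , e) = inj₁ e
  ... | inj₂ (_ , e) = inj₂ e
  complete : ∃[ T ] (∀ t → T ≤ t → digit r t i ≡ suc (q i))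
  complete with T , eq ← -1≡⇒produced r-1 (suc i) = T , λ t T≤t → case invariant t of λ where
    (inj₁ (le , _)) → contradiction (≤-trans (≤-trans (≤-reflexive (sym eq)) (produced-mono r T≤t)) le) (<⇒≱ ≤-refl)
    (inj₂ (_ , e))  → e

-- At each stage the next entry that is still missing is output if its
-- approximation has stabilised, and 0 otherwise.

settled : (ℕ → Baire) → ℕ → ℕ
settled A = primrec 0 (λ t j → ifz (A t j) j (suc j))

emit : (ℕ → Baire) → Baire
emit A t = A t (settled A t)

emit-produced : ∀ A t → produced (emit A) t ≡ settled A t
emit-produced A zero = refl
emit-produced A (suc t) rewrite emit-produced A t = refl

-- What is output is correct because the approximations are never wrong, and the output never stalls
-- because the entry it waits for settles at some stage.
emit-names : ∀ {A o} → A Approximates o → emit A -1≡ o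
emit-names {A} {o} approx = Emits⇒-1≡ emits unbounded
  where
  emits : ∀ t → Emits (emit A) o t
  emits t rewrite emit-produced A t = proj₁ (approx (settled A t)) t
  settled-suc : ∀ {t n v} → settled A t ≡ n → A t n ≡ v → settled A (suc t) ≡ ifz v n (suc n)
  settled-suc refl refl = refl
  wait : ∀ n t → settled A t ≡ n → ∀ d → settled A (t + d) ≡ n ⊎ ∃[ t′ ] settled A t′ ≡ suc n
  wait n t eq zero    = inj₁ (trans (cong (settled A) (+-identityʳ t)) eq)
  wait n t eq (suc d) with wait n t eq d
  ... | inj₂ done = inj₂ done
  ... | inj₁ e with A (t + d) n in a
  ...   | zero  = inj₁ (trans (cong (settled A) (+-suc t d)) (settled-suc e a))
  ...   | suc _ = inj₂ (suc (t + d) , settled-suc e a)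
  reach : ∀ n → ∃[ t ] settled A t ≡ n
  reach zero    = 0 , refl
  reach (suc n) with t , eq ← reach n | T , c ← proj₂ (approx n) with wait n t eq T
  ... | inj₂ done = done
  -- At stage `t + T` the approximation of entry `n` is final, so the entry is output there.
  ... | inj₁ e    = suc (t + T) , settled-suc e (c (t + T) (m≤n+m T t))
  unbounded : ∀ n → ∃[ t ] produced (emit A) t ≡ n
  unbounded n with t , eq ← reach n = t , trans (emit-produced A t) eq

-- The blanks of `r` are its entries 0, and the blanks of `q` come from entries 1 of `r`. `pred`
-- makes both 0 and takes one off every other entry, so one decoding then does the work of two.
-1≡-pred : ∀ {r q o} → r -1≡ q → q -1≡ o → (pred ∘ r) -1≡ o
-1≡-pred {r} {q} r-1 q-1 n with k , eq ← q-1 n with l , eq′ ← r-1 k =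
  l , trans (lemma r l) (trans (cong (concatMap word) eq′) eq)
  where
  lemma : ∀ r l → concatMap word (applyUpTo (pred ∘ r) l) ≡
                  concatMap word (concatMap word (applyUpTo r l))
  lemma r zero = refl
  lemma r (suc l) with r 0
  ... | zero  = lemma (r ∘ suc) l
  ... | suc v = cong (word v List.++_) (lemma (r ∘ suc) l)

-- Classes of total functionals and a toolkit of members.

Functional : ℕ → Set
Functional k = Baire → Vec ℕ k → ℕ

-- In `∈subst` the new oracle may depend on the arguments, so a stage or a component index can
-- select what the inner functional sees. Composition is the case of an unchanged oracle.
record FunctionalClass : Set₁ where
  field
    Member      : ∀ {k} → Functional k → Set
    respects    : ∀ {k} {F G : Functional k} → (∀ p xs → F p xs ≡ G p xs) → Member F → Member G
    extensional : ∀ {k} {F : Functional k} → Member F → ∀ {p p′} → p ≗ p′ → ∀ xs → F p xs ≡ F p′ xs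
    ∈zero       : ∀ {k} → Member {k} (λ _ _ → 0)
    ∈suc        : ∀ {k} {F : Functional k} → Member F → Member (λ p xs → suc (F p xs))
    ∈oracle     : ∀ {k} {F : Functional k} → Member F → Member (λ p xs → p (F p xs))
    ∈proj       : ∀ {k} (i : Fin k) → Member (λ _ xs → lookup xs i)
    ∈primrec    : ∀ {k} {N Z : Functional k} {S} → Member N → Member Z → Member S →
                  Member (λ p xs → primrec (Z p xs) (λ m y → S p (m ∷ y ∷ xs)) (N p xs))
    ∈subst      : ∀ {k l} {F : Functional k} {U : Functional (suc l)} {Gs : Vec (Functional l) k} →
                  Member F → Member U → All Member Gs →
                  Member (λ p xs → F (λ i → U p (i ∷ xs)) (map (λ G → G p xs) Gs))

module Functionals (C : FunctionalClass) where
  open FunctionalClass C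

  record Fun (k : ℕ) : Set where
    constructor fun
    field
      {fn}   : Functional k
      member : Member fn

  open Fun public

  -- Trades the underlying functional for a provably equal one, so that later equations hold by
  -- computation.
  as : ∀ {k} (F : Functional k) (G : Fun k) → (∀ p xs → fn G p xs ≡ F p xs) → Fun k
  as F G eq = fun {fn = F} (respects eq (member G))

  zeroF : ∀ {k} → Fun k
  zeroF = fun ∈zero

  sucF oracleF : ∀ {k} → Fun k → Fun k
  sucF F    = fun (∈suc (member F))
  oracleF F = fun (∈oracle (member F))

  var : ∀ {k} → Fin k → Fun k
  var i = fun (∈proj i)

  v0 : ∀ {k} → Fun (1 + k)
  v0 = var zero
  v1 : ∀ {k} → Fun (2 + k)
  v1 = var (suc zero)
  v2 : ∀ {k} → Fun (3 + k)
  v2 = var (suc (suc zero))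
  v3 : ∀ {k} → Fun (4 + k)
  v3 = var (suc (suc (suc zero)))

  primrecF : ∀ {k} → Fun k → Fun k → Fun (2 + k) → Fun k
  primrecF N Z S = fun (∈primrec (member N) (member Z) (member S))

  members : ∀ {k l} (Gs : Vec (Fun k) l) → All Member (map fn Gs)
  members []       = []
  members (G ∷ Gs) = member G ∷ members Gs

  values : ∀ {k l} → Vec (Fun k) l → Baire → Vec ℕ k → Vec ℕ l
  values Gs p xs = map (λ G → G p xs) (map fn Gs)

  substF : ∀ {k l} → Fun k → Fun (suc l) → Vec (Fun l) k → Fun l
  substF F U Gs = fun (∈subst (member F) (member U) (members Gs))

  infixl 20 _$_

  _$_ : ∀ {k l} → Fun k → Vec (Fun l) k → Fun l
  F $ Gs = substF F (oracleF v0) Gs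

  -- Weakening: the first `i` variables, among them those bound by a surrounding recursion, reach
  -- `F` only through `Gs`, while the last `k` are passed on as they are.
  under : ∀ {j k} i → Fun (j + k) → Vec (Fun (i + k)) j → Fun (i + k)
  under {j} {k} i F Gs =
    as (λ p xs → fn F p (values Gs p xs ++ drop i xs)) (F $ (Gs ++ tabulate (λ x → var (i ↑ʳ x))))
       (λ p xs → cong (fn F p) (lemma p xs Gs))
    where
    rest : ∀ p xs {l} (f : Fin l → Fin (i + k)) →
           values (tabulate (λ x → var (f x))) p xs ≡ tabulate (λ x → lookup xs (f x))
    rest p xs {zero}  f = refl
    rest p xs {suc l} f = cong (lookup xs (f zero) ∷_) (rest p xs (f ∘ suc))
    lemma : ∀ p xs {j} (Gs : Vec (Fun (i + k)) j) →
            values (Gs ++ tabulate (λ x → var (i ↑ʳ x))) p xs ≡ values Gs p xs ++ drop i xs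
    lemma p xs [] = trans (rest p xs (i ↑ʳ_)) (trans
      (tabulate-cong (λ x → trans (cong (λ ys → lookup ys (i ↑ʳ x)) (sym (take++drop≡id i xs)))
                                  (lookup-++ʳ (take i xs) (drop i xs) x)))
      (tabulate∘lookup (drop i xs)))
    lemma p xs (G ∷ Gs) = cong (fn G p xs ∷_) (lemma p xs Gs)

  ifzF : ∀ {k} → Fun k → Fun k → Fun k → Fun k
  ifzF x a b = op $ (x ∷ a ∷ b ∷ [])
    where
    op : Fun 3
    op = as (λ _ xs → ifz (lookup xs zero) (lookup xs (suc zero)) (lookup xs (suc (suc zero))))
            (primrecF v0 v1 (var (suc (suc (suc (suc zero))))))
            λ { p (zero ∷ _) → refl ; p (suc _ ∷ _) → refl }

  predF : ∀ {k} → Fun k → Fun k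
  predF x = op $ (x ∷ [])
    where
    op : Fun 1
    op = as (λ _ xs → pred (head xs)) (primrecF v0 zeroF v0) λ { p (zero ∷ []) → refl ; p (suc _ ∷ []) → refl }

  infixl 6 _⊕_ _⊖_

  _⊕_ : ∀ {k} → Fun k → Fun k → Fun k
  x ⊕ y = op $ (x ∷ y ∷ [])
    where
    lemma : ∀ m n → primrec n (λ _ z → suc z) m ≡ m + n
    lemma zero    n = refl
    lemma (suc m) n = cong suc (lemma m n)
    op : Fun 2
    op = as (λ _ xs → head xs + head (tail xs)) (primrecF v0 v1 (sucF v1)) λ { p (m ∷ n ∷ []) → lemma m n }

  _⊖_ : ∀ {k} → Fun k → Fun k → Fun k
  x ⊖ y = op $ (x ∷ y ∷ [])
    where
    lemma : ∀ m n → primrec m (λ _ z → pred z) n ≡ m ∸ n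
    lemma m zero    = refl
    lemma m (suc n) = trans (cong pred (lemma m n)) (pred[m∸n]≡m∸[1+n] m n)
    op : Fun 2
    op = as (λ _ xs → head xs ∸ head (tail xs)) (primrecF v1 v0 (predF v1)) λ { p (m ∷ n ∷ []) → lemma m n }

  triangleF diagonalF unpair₁F unpair₂F parityF halfF : ∀ {k} → Fun k → Fun k

  triangleF x = primrecF v0 zeroF (v1 ⊕ sucF v0) $ (x ∷ [])
  diagonalF x = primrecF v0 zeroF (ifzF (v1 ⊖ (v0 ⊖ triangleF v1)) (sucF v1) v1) $ (x ∷ [])

  unpair₂F x =
    as (λ p xs → proj₂ (unpair (fn x p xs))) (x ⊖ triangleF (diagonalF x)) λ p xs → unpair₂-correct (fn x p xs)
  unpair₁F x =
    as (λ p xs → proj₁ (unpair (fn x p xs))) (diagonalF x ⊖ (x ⊖ triangleF (diagonalF x)))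
       λ p xs → unpair₁-correct (fn x p xs)

  parityF x = primrecF v0 zeroF (sucF zeroF ⊖ v1) $ (x ∷ [])
  halfF x   = primrecF v0 zeroF (v1 ⊕ parityF v0) $ (x ∷ [])

  pairF : ∀ {k} → Fun k → Fun k → Fun k
  pairF x y =
    as (λ p xs → pair (fn x p xs) (fn y p xs)) (triangleF (x ⊕ y) ⊕ y)
       λ p xs → pair-triangle (fn x p xs) (fn y p xs)

  producedF : ∀ {k} → Fun k → Fun k
  producedF t = primrecF v0 zeroF (ifzF (oracleF v0) v1 (sucF v1)) $ (t ∷ [])

  digitF : Fun 2
  digitF = as (λ p xs → digit p (head xs) (head (tail xs)))
    (primrecF v0 zeroF (ifzF (producedF (sucF v0) ⊖ v3) zeroF (ifzF (producedF v0 ⊖ v3) (oracleF v0) v1)))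
    λ { p (t ∷ i ∷ []) → refl }

  -- The arguments of `A` are a stage, a position and a parameter, which will be a component index.
  emitF : Fun 3 → Fun 2
  emitF A = A $ (v0 ∷ settledF ∷ v1 ∷ [])
    where
    settledF : Fun 2
    settledF = primrecF v0 zeroF (ifzF (A $ (v0 ∷ v1 ∷ v3 ∷ [])) v1 (sucF v1))

-- The interface between admissible partial functions and total functionals. `approximable` must
-- cope with every approximation `U` of the input, whereas `admissible` asks only for results on the
-- full input `p`.
record Presentation (Admissible : BairePartial ℓ → Set ℓ) : Set (lsuc ℓ) where
  field
    class : FunctionalClass
  open Functionals class
  field
    approximable : ∀ {F} → Admissible F → Σ[ Φ ∈ Fun 2 ]
      (∀ {p q} → Graph F p q → ∀ {U} → U Approximates p →
       (λ t n → fn Φ (U t) (t ∷ n ∷ [])) Approximates q)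
    admissible   : ∀ {F} (Φ : Fun 2) →
      (∀ {p q} → Graph F p q → (λ t n → fn Φ p (t ∷ n ∷ [])) Approximates q) → Admissible F

-- Computability relative to an oracle.

mutual
  -- Allowing two pointwise equal oracles makes determinism yield extensionality of the computable
  -- functionals as well.
  ⇓-functional : ∀ {p p′} → p ≗ p′ → {e : Code k} → ∀ {xs y y′} →
                 p ⊢ e [ xs ]⇓ y → p′ ⊢ e [ xs ]⇓ y′ → y ≡ y′
  ⇓-functional eq ⇓zero ⇓zero = refl
  ⇓-functional eq ⇓suc ⇓suc = refl
  ⇓-functional eq ⇓oracle ⇓oracle = eq _
  ⇓-functional eq ⇓proj ⇓proj = refl
  ⇓-functional eq (⇓comp ds d) (⇓comp ds′ d′) with refl ← ⇓*-functional eq ds ds′ = ⇓-functional eq d d′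
  ⇓-functional eq (⇓prec-zero d) (⇓prec-zero d′) = ⇓-functional eq d d′
  ⇓-functional eq (⇓prec-suc d e) (⇓prec-suc d′ e′) with refl ← ⇓-functional eq d d′ = ⇓-functional eq e e′
  ⇓-functional eq (⇓mu {n = n} ds d) (⇓mu {n = n′} ds′ d′) with <-cmp n n′
  ... | tri< n<n′ _ _ = contradiction (⇓-functional eq d (proj₂ (ds′ n n<n′))) λ ()
  ... | tri≈ _ n≡n′ _ = n≡n′
  ... | tri> _ _ n′<n = contradiction (⇓-functional eq (proj₂ (ds n′ n′<n)) d′) λ ()

  ⇓*-functional : ∀ {p p′} → p ≗ p′ → {es : Vec (Code k) l} → ∀ {xs ys ys′} →
                  p ⊢ es [ xs ]⇓* ys → p′ ⊢ es [ xs ]⇓* ys′ → ys ≡ ys′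
  ⇓*-functional eq [] [] = refl
  ⇓*-functional eq (d ∷ ds) (d′ ∷ ds′) = cong₂ _∷_ (⇓-functional eq d d′) (⇓*-functional eq ds ds′)

⇓*-projᶜ : ∀ {p} (xs : Vec ℕ k) (f : Fin l → Fin k) →
           p ⊢ tabulate (projᶜ ∘ f) [ xs ]⇓* tabulate (lookup xs ∘ f)
⇓*-projᶜ {l = zero}  xs f = []
⇓*-projᶜ {l = suc l} xs f = ⇓proj ∷ ⇓*-projᶜ xs (f ∘ suc)

⇓*-params : ∀ {p} (xs : Vec ℕ k) (ys : Vec ℕ l) → p ⊢ tabulate (λ i → projᶜ (k ↑ʳ i)) [ xs ++ ys ]⇓* ys
⇓*-params {k} xs ys = subst (_ ⊢ _ [ xs ++ ys ]⇓*_)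
  (trans (tabulate-cong (lookup-++ʳ xs ys)) (tabulate∘lookup ys)) (⇓*-projᶜ (xs ++ ys) (k ↑ʳ_))

⇓*-++ : ∀ {p} {es : Vec (Code c) k} {es′ : Vec (Code c) l} {xs ys ys′} →
        p ⊢ es [ xs ]⇓* ys → p ⊢ es′ [ xs ]⇓* ys′ → p ⊢ es ++ es′ [ xs ]⇓* (ys ++ ys′)
⇓*-++ []       ds′ = ds′
⇓*-++ (d ∷ ds) ds′ = d ∷ ⇓*-++ ds ds′

-- Replaces oracle queries by calls of d, which takes c parameters after
-- the queried index.

module _ (d : Code (1 + c)) where
  mutual
    substᶜ : Code k → Code (k + c)
    substᶜ zeroᶜ          = compᶜ zeroᶜ []
    substᶜ sucᶜ           = compᶜ sucᶜ (projᶜ zero ∷ [])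
    substᶜ oracleᶜ        = d
    substᶜ (projᶜ i)      = projᶜ (i ↑ˡ c)
    -- The parameters are handed on to the outer code, whose oracle calls need them too.
    substᶜ {k} (compᶜ f gs) = compᶜ (substᶜ f) (substᶜ* gs ++ tabulate (λ i → projᶜ (k ↑ʳ i)))
    substᶜ (precᶜ f g)    = precᶜ (substᶜ f) (substᶜ g)
    substᶜ (muᶜ f)        = muᶜ (substᶜ f)

    substᶜ* : Vec (Code k) l → Vec (Code (k + c)) l
    substᶜ* []       = []
    substᶜ* (g ∷ gs) = substᶜ g ∷ substᶜ* gs

  module _ {p u : Baire} {ys : Vec ℕ c} (⇓d : ∀ i → p ⊢ d [ i ∷ ys ]⇓ u i) where
    mutual
      ⇓-subst : ∀ {e : Code k} {xs y} → u ⊢ e [ xs ]⇓ y → p ⊢ substᶜ e [ xs ++ ys ]⇓ y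
      ⇓-subst ⇓zero           = ⇓comp [] ⇓zero
      ⇓-subst ⇓suc            = ⇓comp (⇓proj ∷ []) ⇓suc
      ⇓-subst ⇓oracle         = ⇓d _
      ⇓-subst (⇓proj {i = i} {xs}) = subst (_ ⊢ _ [ _ ]⇓_) (lookup-++ˡ xs ys i) ⇓proj
      ⇓-subst {xs = xs} (⇓comp ds e) = ⇓comp (⇓*-++ (⇓*-subst ds) (⇓*-params xs ys)) (⇓-subst e)
      ⇓-subst (⇓prec-zero e)  = ⇓prec-zero (⇓-subst e)
      ⇓-subst (⇓prec-suc e e′) = ⇓prec-suc (⇓-subst e) (⇓-subst e′)
      ⇓-subst (⇓mu es e)      = ⇓mu (λ m m<n → proj₁ (es m m<n) , ⇓-subst (proj₂ (es m m<n))) (⇓-subst e)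

      ⇓*-subst : ∀ {es : Vec (Code k) l} {xs zs} → u ⊢ es [ xs ]⇓* zs → p ⊢ substᶜ* es [ xs ++ ys ]⇓* zs
      ⇓*-subst []       = []
      ⇓*-subst (e ∷ es) = ⇓-subst e ∷ ⇓*-subst es

ComputableFunctional : Functional k → Set
ComputableFunctional F = ∃[ e ] (∀ p xs → p ⊢ e [ xs ]⇓ F p xs)

computable-all : {Gs : Vec (Functional c) l} → All ComputableFunctional Gs →
                 Σ[ es ∈ Vec (Code c) l ] (∀ p xs → p ⊢ es [ xs ]⇓* map (λ G → G p xs) Gs)
computable-all [] = [] , λ _ _ → []
computable-all ((e , d) ∷ Gs) = let es , ds = computable-all Gs in e ∷ es , λ p xs → d p xs ∷ ds p xs

computable-primrec : ∀ {N Z : Functional k} {S} → ComputableFunctional N → ComputableFunctional Z →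
                     ComputableFunctional S →
                     ComputableFunctional (λ p xs → primrec (Z p xs) (λ m y → S p (m ∷ y ∷ xs)) (N p xs))
computable-primrec {N = N} {Z} {S} (eN , dN) (eZ , dZ) (eS , dS) =
  compᶜ (precᶜ eZ eS) (eN ∷ tabulate projᶜ) ,
  λ p xs → ⇓comp (dN p xs ∷ ⇓*-params [] xs) (iterate p xs (N p xs))
  where
  iterate : ∀ p xs n → p ⊢ precᶜ eZ eS [ n ∷ xs ]⇓ primrec (Z p xs) (λ m y → S p (m ∷ y ∷ xs)) n
  iterate p xs zero    = ⇓prec-zero (dZ p xs)
  iterate p xs (suc n) = ⇓prec-suc (iterate p xs n) (dS p _)

computable-class : FunctionalClass
computable-class = record
  { Member      = ComputableFunctional
  ; respects    = λ { F≗G (e , d) → e , λ p xs → subst (_ ⊢ _ [ _ ]⇓_) (F≗G p xs) (d p xs) }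
  ; extensional = λ { (e , d) p≗p′ xs → ⇓-functional p≗p′ (d _ xs) (d _ xs) }
  ; ∈zero       = compᶜ zeroᶜ [] , λ _ _ → ⇓comp [] ⇓zero
  ; ∈suc        = λ { (e , d) → compᶜ sucᶜ (e ∷ []) , λ p xs → ⇓comp (d p xs ∷ []) ⇓suc }
  ; ∈oracle     = λ { (e , d) → compᶜ oracleᶜ (e ∷ []) , λ p xs → ⇓comp (d p xs ∷ []) ⇓oracle }
  ; ∈proj       = λ i → projᶜ i , λ _ _ → ⇓proj
  ; ∈primrec    = computable-primrec
  ; ∈subst      = λ { (eF , dF) (eU , dU) Gs → let es , ds = computable-all Gs in
                      compᶜ (substᶜ eU eF) (es ++ tabulate projᶜ) ,
                      λ p xs → ⇓comp (⇓*-++ (ds p xs) (⇓*-params [] xs))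
                                     (⇓-subst eU (λ i → dU p (i ∷ xs)) (dF _ _)) }
  }

-- Evaluation with fuel on a partial oracle.

module Evaluation where
  open Functionals computable-class

  ifzs : Vec ℕ l → ℕ → ℕ
  ifzs []       b = b
  ifzs (a ∷ as) b = ifz a 0 (ifzs as b)

  ifzsF : Vec (Fun c) l → Fun c → Fun c
  ifzsF []       b = b
  ifzsF (a ∷ as) b = ifzF a zeroF (ifzsF as b)

  ifzsF-ifzs : ∀ (as : Vec (Fun c) l) b p xs → fn (ifzsF as b) p xs ≡ ifzs (values as p xs) (fn b p xs)
  ifzsF-ifzs []       b p xs = refl
  ifzsF-ifzs (a ∷ as) b p xs = cong (ifz (fn a p xs) 0) (ifzsF-ifzs as b p xs)

  -- State of an unbounded search: 0 while it is running, 1 if it is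
  -- stuck at an undefined value, n + 2 if it has found n.

  search-step : (ℕ → ℕ) → ℕ → ℕ → ℕ
  search-step a m s = ifz s (ifz (a m) 1 (ifz (pred (a m)) (suc (suc m)) 0)) s

  search : (ℕ → ℕ) → ℕ → ℕ
  search a = primrec 0 (search-step a)

  -- evaluate e has the fuel t as its first argument; it returns 0 if
  -- the evaluation has not succeeded and y + 1 if its result is y, and
  -- the oracle is given in the same encoding.

  mutual
    evaluate : Code k → Fun (1 + k)
    evaluate zeroᶜ        = sucF zeroF
    evaluate sucᶜ         = sucF (sucF v1)
    evaluate oracleᶜ      = oracleF v1
    evaluate (projᶜ i)    = sucF (var (suc i))
    evaluate (compᶜ f gs) = ifzsF (evaluate* gs) (evaluate f $ (v0 ∷ map predF (evaluate* gs)))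
    evaluate (precᶜ f g)  = primrecF v1 (under 2 (evaluate f) (v0 ∷ []))
                              (ifzF v1 zeroF (under 4 (evaluate g) (v2 ∷ v0 ∷ predF v1 ∷ [])))
    -- The fuel also bounds the number of search steps. The outer `predF` turns the states 0 and 1
    -- into "no value" and `n + 2` into `n + 1`, the code of the result `n`.
    evaluate (muᶜ f)      = predF (primrecF v0 zeroF
                              (let a = under 3 (evaluate f) (v2 ∷ v0 ∷ []) in
                               ifzF v1 (ifzF a (sucF zeroF) (ifzF (predF a) (sucF (sucF v0)) zeroF)) v1))

    evaluate* : Vec (Code k) l → Vec (Fun (1 + k)) l
    evaluate* []       = []
    evaluate* (g ∷ gs) = evaluate g ∷ evaluate* gs

  values-pred : ∀ (as : Vec (Fun c) l) p xs → values (map predF as) p xs ≡ map pred (values as p xs)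
  values-pred []       p xs = refl
  values-pred (a ∷ as) p xs = cong (_ ∷_) (values-pred as p xs)

  module _ {a : ℕ → Baire} {n} (before : ∀ m → m < n → ∃[ y ] (λ t → a t m) ⇝ suc y)
           (at : (λ t → a t n) ⇝ 0) where

    -- Below `n` a test is either still undefined or non-zero, so the search may get stuck but
    -- cannot stop at a wrong number. With enough fuel the finitely many tests are all defined.
    search-running : ∀ m → m ≤ n → (∀ t → search (a t) m ≡ 0 ⊎ search (a t) m ≡ 1) ×
                     ∃[ T ] (∀ t → T ≤ t → search (a t) m ≡ 0)
    search-running zero    _   = (λ _ → inj₁ refl) , 0 , λ _ _ → refl
    search-running (suc m) m<n with search-running m (<⇒≤ m<n) | before m m<n
    ... | s , T , c | y , s′ , T′ , c′ = sound , T ⊔ T′ , complete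
      where
      sound : ∀ t → search (a t) (suc m) ≡ 0 ⊎ search (a t) (suc m) ≡ 1
      sound t with search (a t) m | s t | a t m | s′ t
      ... | _ | inj₁ refl | _ | inj₁ refl = inj₂ refl
      ... | _ | inj₁ refl | _ | inj₂ refl = inj₁ refl
      ... | _ | inj₂ refl | _ | _         = inj₂ refl
      complete : ∀ t → T ⊔ T′ ≤ t → search (a t) (suc m) ≡ 0
      complete t le with search (a t) m | c t (m⊔n≤o⇒m≤o T T′ le) | a t m | c′ t (m⊔n≤o⇒n≤o T T′ le)
      ... | _ | refl | _ | refl = refl

    search-found : (∀ t → search (a t) (suc n) ≡ 1 ⊎ search (a t) (suc n) ≡ 2 + n) ×
                   ∃[ T ] (∀ t → T ≤ t → search (a t) (suc n) ≡ 2 + n)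
    search-found with search-running n ≤-refl , at
    ... | (s , T , c) , (s′ , T′ , c′) = sound , T ⊔ T′ , complete
      where
      sound : ∀ t → search (a t) (suc n) ≡ 1 ⊎ search (a t) (suc n) ≡ 2 + n
      sound t with search (a t) n | s t | a t n | s′ t
      ... | _ | inj₁ refl | _ | inj₁ refl = inj₁ refl
      ... | _ | inj₁ refl | _ | inj₂ refl = inj₂ refl
      ... | _ | inj₂ refl | _ | _         = inj₁ refl
      complete : ∀ t → T ⊔ T′ ≤ t → search (a t) (suc n) ≡ 2 + n
      complete t le with search (a t) n | c t (m⊔n≤o⇒m≤o T T′ le) | a t n | c′ t (m⊔n≤o⇒n≤o T T′ le)
      ... | _ | refl | _ | refl = refl

    search-stable : ∀ {t m s} → m ≤ t → search (a t) m ≡ suc s → search (a t) t ≡ suc s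
    search-stable {t} {m} {s} m≤t eq with d , eq′ ← m≤n⇒∃[o]m+o≡n m≤t =
      trans (cong (search (a t)) (sym eq′)) (go d)
      where
      keep : ∀ m → search (a t) m ≡ suc s → search (a t) (suc m) ≡ suc s
      keep m e with search (a t) m | e
      ... | _ | refl = refl
      go : ∀ d → search (a t) (m + d) ≡ suc s
      go zero    = trans (cong (search (a t)) (+-identityʳ m)) eq
      go (suc d) = trans (cong (search (a t)) (+-suc m d)) (keep (m + d) (go d))

    search-⇝ : (λ t → pred (search (a t) t)) ⇝ n
    -- The fuel must reach the stage `T` and also pay for the `n + 1` search steps.
    search-⇝ = sound , T ⊔ suc n , complete
      where
      T : ℕ
      T = proj₁ (proj₂ search-found)
      sound : ∀ t → pred (search (a t) t) ≡ 0 ⊎ pred (search (a t) t) ≡ suc n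
      sound t with ≤-<-connex t n
      ... | inj₁ t≤n with proj₁ (search-running t t≤n) t
      ...   | inj₁ eq = inj₁ (cong pred eq)
      ...   | inj₂ eq = inj₁ (cong pred eq)
      sound t | inj₂ n<t with proj₁ search-found t
      ...   | inj₁ eq = inj₁ (cong pred (search-stable n<t eq))
      ...   | inj₂ eq = inj₂ (cong pred (search-stable n<t eq))
      complete : ∀ t → T ⊔ suc n ≤ t → pred (search (a t) t) ≡ suc n
      complete t le = cong pred (search-stable (m⊔n≤o⇒n≤o T (suc n) le)
                                  (proj₂ (proj₂ search-found) t (m⊔n≤o⇒m≤o T (suc n) le)))

  module _ {p : Baire} {U : ℕ → Baire} (U-p : U Approximates p) where
    mutual
      evaluate-⇝ : ∀ {e : Code k} {xs y} → p ⊢ e [ xs ]⇓ y → (λ t → fn (evaluate e) (U t) (t ∷ xs)) ⇝ y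
      evaluate-⇝ ⇓zero         = ⇝-const _
      evaluate-⇝ ⇓suc          = ⇝-const _
      evaluate-⇝ ⇓oracle       = U-p _
      evaluate-⇝ ⇓proj         = ⇝-const _
      evaluate-⇝ {xs = xs} (⇓comp {f = f} {gs} ds d) = ⇝-cong
        (λ t → sym (trans (ifzsF-ifzs (evaluate* gs) (evaluate f $ (v0 ∷ map predF (evaluate* gs))) (U t) (t ∷ xs))
                          (cong (λ ys → ifzs (values (evaluate* gs) (U t) (t ∷ xs)) (fn (evaluate f) (U t) (t ∷ ys)))
                                (values-pred (evaluate* gs) (U t) (t ∷ xs)))))
        (evaluate*-⇝ ds (λ t ys → fn (evaluate f) (U t) (t ∷ ys)) (evaluate-⇝ d))
      evaluate-⇝ (⇓prec-zero d) = evaluate-⇝ d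
      evaluate-⇝ {xs = suc n ∷ xs} (⇓prec-suc {g = g} d e) =
        ⇝-bind (λ t y → fn (evaluate g) (U t) (t ∷ n ∷ y ∷ xs)) (evaluate-⇝ d) (evaluate-⇝ e)
      evaluate-⇝ {xs = xs} (⇓mu {f = f} ds d) =
        search-⇝ {a = λ t m → fn (evaluate f) (U t) (t ∷ m ∷ xs)}
          (λ m m<n → proj₁ (ds m m<n) , evaluate-⇝ (proj₂ (ds m m<n))) (evaluate-⇝ d)

      -- The continuation `b` absorbs the values found so far, so that `⇝-bind` can be iterated
      -- along the vector.
      evaluate*-⇝ : ∀ {es : Vec (Code k) l} {xs ys z} → p ⊢ es [ xs ]⇓* ys →
                    (b : ℕ → Vec ℕ l → ℕ) → (λ t → b t ys) ⇝ z →
                    (λ t → ifzs (values (evaluate* es) (U t) (t ∷ xs))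
                                (b t (map pred (values (evaluate* es) (U t) (t ∷ xs))))) ⇝ z
      evaluate*-⇝ [] b h = h
      evaluate*-⇝ {es = e ∷ es} {xs} (d ∷ ds) b h =
        ⇝-bind (λ t y → ifzs (values (evaluate* es) (U t) (t ∷ xs))
                             (b t (y ∷ map pred (values (evaluate* es) (U t) (t ∷ xs)))))
          (evaluate-⇝ d) (evaluate*-⇝ ds (λ t ys → b t (_ ∷ ys)) h)

least-success : ∀ (a : Baire) T {y} → a T ≡ suc y → ∃[ n ] ∃[ z ] a n ≡ suc z × (∀ m → m < n → a m ≡ 0)
least-success a zero    eq = 0 , _ , eq , λ _ ()
least-success a (suc T) eq with a 0 in a0
... | suc z = 0 , z , a0 , λ _ ()
... | zero  with n , z , eq′ , below ← least-success (a ∘ suc) T eq =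
  suc n , z , eq′ , λ where
    zero    _   → a0
    (suc m) m<n → below m (s<s⁻¹ m<n)

computable-presentation : Presentation {ℓ} Computable
computable-presentation = record
  { class        = computable-class
  ; approximable = λ { (e , d) → evaluate e , λ Fpq U-p n → evaluate-⇝ U-p (d Fpq n) }
  ; admissible   = λ {F} → admissible {F = F}
  }
  where
  open Functionals computable-class
  open Evaluation
  admissible : ∀ {F : BairePartial ℓ} (Φ : Fun 2) →
    (∀ {p q} → Graph F p q → (λ t n → fn Φ p (t ∷ n ∷ [])) Approximates q) → Computable F
  admissible {F = F} Φ approx = compᶜ eV (muᶜ eZ ∷ projᶜ zero ∷ []) , λ {p} {q} → correct {p} {q}
    where
    value missing : Fun 2
    value   = predF Φ
    -- This is 0 exactly at the stages where `Φ` has a value, which is what `muᶜ` searches for; by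
    -- soundness the first value found is the right one.
    missing = ifzF Φ (sucF zeroF) zeroF
    eV eZ : Code 2
    eV = proj₁ (member value)
    eZ = proj₁ (member missing)
    correct : ∀ {p q} → Graph F p q → ∀ n → p ⊢ compᶜ eV (muᶜ eZ ∷ projᶜ zero ∷ []) [ n ∷ [] ]⇓ q n
    correct {p} {q} Fpq n with s , T , c ← approx Fpq n
      with t , z , eq , below ← least-success (λ t → fn Φ p (t ∷ n ∷ [])) T (c T ≤-refl) =
      ⇓comp (⇓mu (λ m m<t → 0 , subst (p ⊢ eZ [ m ∷ n ∷ [] ]⇓_) (cong (λ v → ifz v 1 0) (below m m<t))
                                      (proj₂ (member missing) p (m ∷ n ∷ [])))
                 (subst (p ⊢ eZ [ t ∷ n ∷ [] ]⇓_) (cong (λ v → ifz v 1 0) eq)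
                        (proj₂ (member missing) p (t ∷ n ∷ [])))
             ∷ ⇓proj ∷ [])
            (subst (p ⊢ eV [ t ∷ n ∷ [] ]⇓_) (value-correct (s t)) (proj₂ (member value) p (t ∷ n ∷ [])))
      where
      value-correct : fn Φ p (t ∷ n ∷ []) ≡ 0 ⊎ fn Φ p (t ∷ n ∷ []) ≡ suc (q n) →
                      pred (fn Φ p (t ∷ n ∷ [])) ≡ q n
      value-correct (inj₁ e) = contradiction (trans (sym eq) e) λ ()
      value-correct (inj₂ e) = cong pred e

-- Continuity, in terms of basic open neighbourhoods of `p`.

Near : Baire → (Baire → Set) → Set
Near p Q = ∃[ m ] (∀ p′ → (∀ i → i < m → p i ≡ p′ i) → Q p′)

near-always : ∀ {p Q} → (∀ p′ → Q p′) → Near p Q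
near-always h = 0 , λ p′ _ → h p′

near-at : ∀ {p} i → Near p (λ p′ → p i ≡ p′ i)
near-at i = suc i , λ p′ agree → agree i ≤-refl

near-map : ∀ {p Q R} → (∀ p′ → Q p′ → R p′) → Near p Q → Near p R
near-map f (m , h) = m , λ p′ agree → f p′ (h p′ agree)

near-map₂ : ∀ {p Q R S} → (∀ p′ → Q p′ → R p′ → S p′) → Near p Q → Near p R → Near p S
near-map₂ f (m , h) (m′ , h′) = m ⊔ m′ , λ p′ agree →
  f p′ (h p′ λ i i<m → agree i (≤-trans i<m (m≤m⊔n m m′)))
       (h′ p′ λ i i<m′ → agree i (≤-trans i<m′ (m≤n⊔m m m′)))

near-∀< : ∀ {p} {Q : ℕ → Baire → Set} n → (∀ i → Near p (Q i)) → Near p (λ p′ → ∀ i → i < n → Q i p′)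
near-∀< zero    h = near-always λ _ _ ()
near-∀< {Q = Q} (suc n) h = near-map₂
  (λ p′ q₀ q → λ { zero _ → q₀ ; (suc i) i<n → q i (s<s⁻¹ i<n) })
  (h 0) (near-∀< {Q = λ i → Q (suc i)} n (h ∘ suc))

ContinuousFunctional : Functional k → Set
ContinuousFunctional F = ∀ p xs → Near p (λ p′ → F p xs ≡ F p′ xs)

-- The number of recursion steps is locally constant, so near `p` a fixed finite iteration has to be
-- continuous.
continuous-primrec : ∀ {N Z : Functional k} {S} → ContinuousFunctional N → ContinuousFunctional Z →
                     ContinuousFunctional S →
                     ContinuousFunctional (λ p xs → primrec (Z p xs) (λ m y → S p (m ∷ y ∷ xs)) (N p xs))
continuous-primrec {N = N} {Z} {S} cN cZ cS p xs =
  near-map₂ (λ p′ e e′ → trans e′ (cong (value p′) e)) (cN p xs) (iterate (N p xs))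
  where
  value : Baire → ℕ → ℕ
  value p′ = primrec (Z p′ xs) (λ m y → S p′ (m ∷ y ∷ xs))
  iterate : ∀ n → Near p (λ p′ → value p n ≡ value p′ n)
  iterate zero    = cZ p xs
  iterate (suc n) = near-map₂ (λ p′ e e′ → trans e′ (cong (λ y → S p′ (n ∷ y ∷ xs)) e))
                      (iterate n) (cS p (n ∷ value p n ∷ xs))

continuous-all : {Gs : Vec (Functional c) l} → All ContinuousFunctional Gs → ∀ p xs →
                 Near p (λ p′ → map (λ G → G p xs) Gs ≡ map (λ G → G p′ xs) Gs)
continuous-all []       p xs = near-always λ _ → refl
continuous-all (g ∷ gs) p xs = near-map₂ (λ _ → cong₂ _∷_) (g p xs) (continuous-all gs p xs)

-- `F` looks at finitely many entries of the substituted oracle, and each of these is locally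
-- constant in `p`.
continuous-subst : ∀ {F : Functional k} {U : Functional (suc l)} {Gs : Vec (Functional l) k} →
                   ContinuousFunctional F → ContinuousFunctional U → All ContinuousFunctional Gs →
                   ContinuousFunctional (λ p xs → F (λ i → U p (i ∷ xs)) (map (λ G → G p xs) Gs))
continuous-subst {F = F} {U} {Gs} cF cU cGs p xs
  with m , h ← cF (λ i → U p (i ∷ xs)) (map (λ G → G p xs) Gs) =
  near-map₂ (λ p′ agree e → trans (h (λ i → U p′ (i ∷ xs)) agree) (cong (F _) e))
    (near-∀< m (λ i → cU p (i ∷ xs))) (continuous-all cGs p xs)

continuous-class : FunctionalClass
continuous-class = record
  { Member      = ContinuousFunctional
  ; respects    = λ F≗G cF p xs →
                  near-map (λ p′ e → trans (sym (F≗G p xs)) (trans e (F≗G p′ xs))) (cF p xs)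
  ; extensional = λ cF {p} {p′} p≗p′ xs → proj₂ (cF p xs) p′ λ i _ → p≗p′ i
  ; ∈zero       = λ p xs → near-always λ _ → refl
  ; ∈suc        = λ cF p xs → near-map (λ _ → cong suc) (cF p xs)
  ; ∈oracle     = λ {_} {F} cF p xs →
                  near-map₂ (λ p′ e e′ → trans e (cong p′ e′)) (near-at (F p xs)) (cF p xs)
  ; ∈proj       = λ i p xs → near-always λ _ → refl
  ; ∈primrec    = λ {_} {N} {Z} {S} → continuous-primrec {N = N} {Z} {S}
  ; ∈subst      = λ {_} {_} {F} {U} {Gs} → continuous-subst {F = F} {U} {Gs}
  }

module _ (em : ExcludedMiddle ℓ) where

  module _ (F : BairePartial ℓ) where

    Extends : Baire → ℕ → Baire → Set
    Extends u t p = ∀ i → i < t → u i ≡ 0 ⊎ u i ≡ suc (p i)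

    -- The first t entries of the partial sequence u determine the value
    -- v at n.  Without the first conjunct v would not be unique.

    Forces : Baire → ℕ → ℕ → ℕ → Set ℓ
    Forces u t n v = (∃₂ λ p q → Graph F p q × Extends u t p × q n ≡ v) ×
                     (∀ {p q} → Graph F p q → Extends u t p → q n ≡ v)

    forced : ∀ {u t n} → Dec (∃ (Forces u t n)) → ℕ
    forced (yes (v , _)) = suc v
    forced (no _)        = 0

    -- Excluded middle decides whether a value is forced, which makes this total. Only the first `t`
    -- entries of `u` enter, so `t` is a modulus of continuity.
    forcing : Functional 2
    forcing u (t ∷ n ∷ []) = forced {u} {t} {n} em

    forces-cong : ∀ {u u′ t n v} → (∀ i → i < t → u i ≡ u′ i) → Forces u t n v → Forces u′ t n v
    forces-cong {u} {u′} {t} agree ((p , q , Fpq , ext , eq) , h) =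
      (p , q , Fpq , (λ i i<t → subst (λ x → x ≡ 0 ⊎ x ≡ suc (p i)) (agree i i<t) (ext i i<t)) , eq) ,
      λ {p} Fpq ext → h Fpq λ i i<t → subst (λ x → x ≡ 0 ⊎ x ≡ suc (p i)) (sym (agree i i<t)) (ext i i<t)

    forcing-continuous : ContinuousFunctional forcing
    forcing-continuous u (t ∷ n ∷ []) = t , λ u′ agree → same u′ agree em em
      where
      same : ∀ u′ → (∀ i → i < t → u i ≡ u′ i) → (d : Dec (∃ (Forces u t n))) (d′ : Dec (∃ (Forces u′ t n))) →
             forced {u} {t} {n} d ≡ forced {u′} {t} {n} d′
      same u′ agree (no _) (no _) = refl
      same u′ agree (yes (v , f)) (no ¬f) = contradiction (v , forces-cong agree f) ¬f
      same u′ agree (no ¬f) (yes (v , f)) = contradiction (v , forces-cong (λ i i<t → sym (agree i i<t)) f) ¬f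
      same u′ agree (yes (v , f)) (yes (v′ , f′)) with (_ , _ , Fpq , ext , eq) , _ ← forces-cong agree f =
        cong suc (trans (sym eq) (proj₂ f′ Fpq ext))

    -- Sound, because `p` itself extends `U t`, so a forced value is `q n`. Complete, because once
    -- the entries below the modulus of continuity are known, every extension agrees with `p` on
    -- them.
    forcing-approximates : Continuous F → ∀ {p q} → Graph F p q → ∀ {U} → U Approximates p →
                           (λ t n → forcing (U t) (t ∷ n ∷ [])) Approximates q
    forcing-approximates cont {p} {q} Fpq {U} U-p n = (λ t → sound t em) , complete
      where
      extends : ∀ t → Extends (U t) t p
      extends t i _ = proj₁ (U-p i) t
      sound : ∀ t (d : Dec (∃ (Forces (U t) t n))) →
              forced {U t} {t} {n} d ≡ 0 ⊎ forced {U t} {t} {n} d ≡ suc (q n)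
      sound t (yes (v , _ , h)) = inj₂ (cong suc (sym (h Fpq (extends t))))
      sound t (no _)            = inj₁ refl
      complete : ∃[ T ] (∀ t → T ≤ t → forcing (U t) (t ∷ n ∷ []) ≡ suc (q n))
      -- The modulus is taken at `suc n` because agreement is only asserted strictly below its
      -- argument.
      complete with m , modulus ← cont Fpq (suc n)
        with T , known ← eventually-∀< m (λ i _ → proj₂ (U-p i)) =
        T ⊔ m , λ t le → force t (m⊔n≤o⇒m≤o T m le) (m⊔n≤o⇒n≤o T m le) em
        where
        force : ∀ t → T ≤ t → m ≤ t → (d : Dec (∃ (Forces (U t) t n))) → forced {U t} {t} {n} d ≡ suc (q n)
        force t T≤t m≤t (yes (v , _ , h)) = cong suc (sym (h Fpq (extends t)))
        force t T≤t m≤t (no ¬f) = contradiction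
          (q n , (p , q , Fpq , extends t , refl) , λ {p′} {q′} Fp′q′ ext →
            sym (modulus Fp′q′ (λ i i<m → agree p′ i i<m (ext i (≤-trans i<m m≤t))) n ≤-refl)) ¬f
          where
          agree : ∀ p′ i → i < m → U t i ≡ 0 ⊎ U t i ≡ suc (p′ i) → p i ≡ p′ i
          agree p′ i i<m (inj₁ e) = contradiction (trans (sym (known t T≤t i i<m)) e) λ ()
          agree p′ i i<m (inj₂ e) = suc-injective (trans (sym (known t T≤t i i<m)) e)

  continuous-presentation : Presentation {ℓ} Continuous
  continuous-presentation = record
    { class        = continuous-class
    ; approximable = λ {F} cont → fun (forcing-continuous F) , forcing-approximates F cont
    ; admissible   = λ {F} → admissible {F}
    }
    where
    open Functionals continuous-class
    admissible : ∀ {F : BairePartial ℓ} (Φ : Fun 2) →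
      (∀ {p q} → Graph F p q → (λ t n → fn Φ p (t ∷ n ∷ [])) Approximates q) → Continuous F
    admissible {F} Φ approx {p} {q} Fpq n =
      -- Take for each `i < n` a stage at which `q i` has appeared. Near `p` this non-zero value
      -- persists, and soundness at `p′` identifies it as the code of `q′ i`.
      let m , h = near-∀< n (λ i → member Φ p (stage i ∷ i ∷ [])) in
      m , λ {p′} Fp′q′ agree i i<n →
        same (h p′ agree i i<n) (proj₂ (proj₂ (approx Fpq i)) (stage i) ≤-refl) (proj₁ (approx Fp′q′ i) (stage i))
      where
      stage : ℕ → ℕ
      stage i = proj₁ (proj₂ (approx Fpq i))
      same : ∀ {a b x y} → a ≡ b → a ≡ suc x → b ≡ 0 ⊎ b ≡ suc y → x ≡ y
      same refl e (inj₁ e′) = contradiction (trans (sym e) e′) λ ()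
      same refl e (inj₂ e′) = suc-injective (trans (sym e) e′)

-- Weak and strong reductions in a common form.

-- The two reducibilities differ in how H sees the original input:
-- attach F maps p to join p (F p).

record Joining (ℓ : Level) (C : FunctionalClass) : Set (lsuc ℓ) where
  open Functionals C
  field
    attach      : BairePartial ℓ → BairePartial ℓ
    join        : Baire → Baire → Baire
    join-congʳ  : ∀ p {q q′} → q ≗ q′ → join p q ≗ join p q′
    attach-join : ∀ F {p r} → Graph (attach F) p r → ∃[ q ] Graph F p q × r ≗ join p q
    join-attach : ∀ F {p q} → Graph F p q → Graph (attach F) p (join p q)
    right       : Fun 1
    right-join  : ∀ p q i → fn right (join p q) (i ∷ []) ≡ q i
    -- The arguments of B and joinF B are a position i in the sequence, the
    -- index n of a component of p and a stage t.
    joinF       : Fun 3 → Fun 3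
    joinF-approximates : ∀ B n {p r q} →
      (λ t i → fn B (join p r) (i ∷ n ∷ t ∷ [])) Approximates q →
      (λ t i → fn (joinF B) (join p r) (i ∷ n ∷ t ∷ [])) Approximates join (component p n) q

strong-joining : ∀ C → Joining ℓ C
strong-joining C = record
  { attach             = id
  ; join               = λ _ q → q
  ; join-congʳ         = λ _ q≗q′ → q≗q′
  ; attach-join        = λ _ {_} {r} Fpr → r , Fpr , λ _ → refl
  ; join-attach        = λ _ Fpq → Fpq
  ; right              = oracleF v0
  ; right-join         = λ _ _ _ → refl
  ; joinF              = id
  ; joinF-approximates = λ _ _ approx → approx
  }
  where open Functionals C

weak-joining : ∀ C → Joining ℓ C
weak-joining C = record
  { attach             = ⟨id,_⟩
  ; join               = ⟨_,_⟩
  ; join-congʳ         = λ p {q} {q′} q≗q′ m →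
      trans (sym (⟨,⟩-ifz p q m)) (trans (cong (ifz (parity m) (p (half m))) (q≗q′ (half m))) (⟨,⟩-ifz p q′ m))
  ; attach-join        = λ _ Fpr → Fpr
  ; join-attach        = λ _ {_} {q} Fpq → q , Fpq , λ _ → refl
  ; right              = oracleF (sucF (v0 ⊕ v0))
  ; right-join         = ⟨,⟩-odd
  ; joinF              = joinF
  ; joinF-approximates = approximates
  }
  where
  open Functionals C
  joinF : Fun 3 → Fun 3
  -- Even positions are read off the copy of `p` inside the oracle, with a successor because they
  -- are known at every stage.
  joinF B = ifzF (parityF v0) (sucF (oracleF (index ⊕ index))) (B $ (halfF v0 ∷ v1 ∷ v2 ∷ []))
    where
    index : Fun 3
    index = pairF v1 (halfF v0)
  approximates : ∀ B n {p r q} →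
    (λ t i → fn B ⟨ p , r ⟩ (i ∷ n ∷ t ∷ [])) Approximates q →
    (λ t i → fn (joinF B) ⟨ p , r ⟩ (i ∷ n ∷ t ∷ [])) Approximates ⟨ component p n , q ⟩
  approximates B n {p} {r} {q} approx i =
    subst (_ ⇝_) (⟨,⟩-ifz (component p n) q i) (choose (parity i))
    where
    choose : ∀ b → (λ t → ifz b (suc (⟨ p , r ⟩ (pair n (half i) + pair n (half i))))
                                (fn B ⟨ p , r ⟩ (half i ∷ n ∷ t ∷ []))) ⇝
                   ifz b (component p n (half i)) (q (half i))
    choose zero    = ⇝-cong (λ _ → cong suc (sym (⟨,⟩-even p r (pair n (half i))))) (⇝-const _)
    choose (suc _) = approx (half i)

-- The three laws for an arbitrary presentation and joining.

completion-total : ExcludedMiddle ℓ → ∀ (Y : RepresentedSpace ℓ) p →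
                   ∃ (Graph (RepresentedSpace.δ (completion Y)) p)
completion-total em Y p with em {P = ∃₂ λ q y → p -1≡ q × Graph (RepresentedSpace.δ Y) q y}
... | yes (q , y , named) = just y , q , named
... | no unnamed          = nothing , unnamed

module StashIsInterior
  {ℓ} (em : ExcludedMiddle ℓ) {Admissible : BairePartial ℓ → Set ℓ} (P : Presentation Admissible)
  (J : Joining ℓ (Presentation.class P))
  where

  open Presentation P
  open Functionals class
  open Joining J

  infix 4 _≼_

  _≼_ : Problem ℓ → Problem ℓ → Set (lsuc ℓ)
  f ≼ g = ∃₂ λ (H K : BairePartial ℓ) → Admissible H × Admissible K ×
          (∀ G → G IsRealizerOf g → (H ∘ᵖ attach (G ∘ᵖ K)) IsRealizerOf f)

  -- The quantification over realizers of g amounts to a quantification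
  -- over the names of single solutions.

  IsReduction : (f g : Problem ℓ) (H K : BairePartial ℓ) → Set ℓ
  IsReduction f g H K =
    ∀ {p x} → Graph (X.δ) p x → f.dom x →
    ∃[ w ] Graph K p w × (∃[ u ] Graph (U.δ) w u × g.dom u ×
      (∀ {q v} → Graph (V.δ) q v → g.Solution u v →
       ∃[ r ] Graph H (join p q) r × (∃[ y ] Graph (Y.δ) r y × f.Solution x y)))
    where
    module f = Problem f
    module g = Problem g
    module X = RepresentedSpace f.source
    module Y = RepresentedSpace f.target
    module U = RepresentedSpace g.source
    module V = RepresentedSpace g.target

  reduction⇒≼ : ∀ {f g H K} → Admissible H → Admissible K → IsReduction f g H K → f ≼ g
  reduction⇒≼ {f} {g} {H} {K} aH aK red = H , K , aH , aK , λ G realizes δpx x∈dom →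
    let w , Kpw , u , δwu , u∈dom , solve = red δpx x∈dom
        q , Gwq , v , δqv , uv = realizes δwu u∈dom
        r , Hr , y , δry , xy = solve δqv uv
    in r , (join _ q , join-attach (G ∘ᵖ K) (w , Kpw , Gwq) , Hr) , y , δry , xy

  module _ (g : Problem ℓ) where
    private
      module g = Problem g
      module U = RepresentedSpace g.source
      module V = RepresentedSpace g.target
      module δU = PartialFunction U.δ
    open PartialFunction

    -- Being undefined off names of instances, this realizer shows that `K` produces such a name.
    restricted : BairePartial ℓ
    restricted = record
      { Graph      = λ p q → Graph G p q × ∃[ u ] Graph U.δ p u × g.dom u
      ; respˡ      = λ { p≗p′ (Gpq , u , δpu , u∈dom) → respˡ G p≗p′ Gpq , u , respˡ U.δ p≗p′ δpu , u∈dom }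
      ; respʳ      = λ { q≗q′ (Gpq , rest) → respʳ G q≗q′ Gpq , rest }
      ; functional = λ { (Gpq , _) (Gpq′ , _) → functional G Gpq Gpq′ }
      }
      where
      G : BairePartial ℓ
      G = proj₁ g.realizer

    restricted-realizes : restricted IsRealizerOf g
    restricted-realizes {p} {u} δpu u∈dom =
      let q , Gpq , rest = proj₂ g.realizer δpu u∈dom in q , (Gpq , u , δpu , u∈dom) , rest

    redirected : Baire → Baire → BairePartial ℓ
    redirected w q₀ = record
      { Graph      = λ p q → (p ≗ w × q ≗ q₀) ⊎ (¬ (p ≗ w) × Graph G p q)
      ; respˡ      = λ where
          p≗p′ (inj₁ (p≗w , q≗))  → inj₁ ((λ n → trans (sym (p≗p′ n)) (p≗w n)) , q≗)
          p≗p′ (inj₂ (p≢w , Gpq)) → inj₂ ((λ p′≗w → p≢w λ n → trans (p≗p′ n) (p′≗w n)) , respˡ G p≗p′ Gpq)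
      ; respʳ      = λ where
          q≗q′ (inj₁ (p≗w , q≗))  → inj₁ (p≗w , λ n → trans (sym (q≗q′ n)) (q≗ n))
          q≗q′ (inj₂ (p≢w , Gpq)) → inj₂ (p≢w , respʳ G q≗q′ Gpq)
      ; functional = λ where
          (inj₁ (_ , q≗))   (inj₁ (_ , q′≗))   n → trans (q≗ n) (sym (q′≗ n))
          (inj₁ (p≗w , _))  (inj₂ (p≢w , _))   → contradiction p≗w p≢w
          (inj₂ (p≢w , _))  (inj₁ (p≗w , _))   → contradiction p≗w p≢w
          (inj₂ (_ , Gpq))  (inj₂ (_ , Gpq′))  → functional G Gpq Gpq′
      }
      where
      G : BairePartial ℓ
      G = proj₁ g.realizer

    redirected-realizes : ∀ {w u q v} → Graph U.δ w u → Graph V.δ q v → g.Solution u v →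
                          redirected w q IsRealizerOf g
    redirected-realizes {w} {u} {q} {v} δwu δqv uv {p} {u′} δpu′ u′∈dom with em {P = Lift ℓ (p ≗ w)}
    ... | yes (lift p≗w) = q , inj₁ (p≗w , λ _ → refl) , v , δqv ,
                           g.respˡ (δU.functional δwu (δU.respˡ p≗w δpu′)) uv
    ... | no p≢w with q′ , Gpq′ , rest ← proj₂ g.realizer δpu′ u′∈dom =
      q′ , inj₂ ((λ p≗w → p≢w (lift p≗w)) , Gpq′) , rest

  -- The restricted realizer provides the instance `u` named by `w`. For each name `q` of a solution
  -- of `u`, the realizer redirected at `w` then feeds exactly `q` to `H`, as `K` is single-valued.
  ≼⇒reduction : ∀ {f g} → f ≼ g → ∃₂ λ H K → Admissible H × Admissible K × IsReduction f g H K
  ≼⇒reduction {f} {g} (H , K , aH , aK , realizes) = H , K , aH , aK , reduction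
    where
    module H = PartialFunction H
    module K = PartialFunction K
    reduction : IsReduction f g H K
    reduction {p} {x} δpx x∈dom
      with _ , (_ , attached , _) , _ ← realizes (restricted g) (restricted-realizes g) δpx x∈dom
      with _ , (w , Kpw , _ , u , δwu , u∈dom) , _ ← attach-join (restricted g ∘ᵖ K) attached =
      w , Kpw , u , δwu , u∈dom , solve
      where
      module g = Problem g
      solve : ∀ {q v} → Graph (RepresentedSpace.δ g.target) q v → g.Solution u v →
              ∃[ r ] Graph H (join p q) r ×
              (∃[ y ] Graph (RepresentedSpace.δ (Problem.target f)) r y × Problem.Solution f x y)
      solve {q} δqv uv
        with r , (_ , attached , Hr) , solution ←
               realizes (redirected g w q) (redirected-realizes g δwu δqv uv) δpx x∈dom
        with attach-join (redirected g w q ∘ᵖ K) attached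
      ... | q′ , (w′ , Kpw′ , inj₁ (_ , q′≗q)) , eq =
        r , H.respˡ (λ n → trans (eq n) (join-congʳ p q′≗q n)) Hr , solution
      ... | q′ , (w′ , Kpw′ , inj₂ (w′≢w , _)) , eq =
        contradiction (K.functional Kpw′ Kpw) w′≢w

  apply : Fun 1 → Baire → Baire
  apply h p n = fn h p (n ∷ [])

  total : Fun 1 → BairePartial ℓ
  total h = record
    { Graph      = λ p q → Lift ℓ (q ≗ apply h p)
    ; respˡ      = λ { p≗p′ (lift eq) →
                       lift λ n → trans (eq n) (FunctionalClass.extensional class (member h) p≗p′ (n ∷ [])) }
    ; respʳ      = λ { q≗q′ (lift eq) → lift λ n → trans (sym (q≗q′ n)) (eq n) }
    ; functional = λ { (lift eq) (lift eq′) n → trans (eq n) (sym (eq′ n)) }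
    }

  total-admissible : ∀ h → Admissible (total h)
  total-admissible h = admissible (sucF (h $ (v1 ∷ [])))
    λ { (lift eq) n → ⇝-cong (λ _ → cong suc (eq n)) (⇝-const _) }

  stash-≼ : ∀ f → stash f ≼ f
  stash-≼ f = reduction⇒≼ {stash f} {f} (total-admissible copy) (total-admissible first)
    λ { {p} {x} names (_ , dom , _) →
      apply first p , lift (λ _ → refl) , x 0 , names 0 , dom 0 ,
      λ {q} {v} δqv xv → apply copy (join p q) , lift (λ _ → refl) , (λ _ → just v) ,
        (λ n → q , -1≡-respˡ (λ k → cong suc (sym (copied p q n k))) (suc-1≡ q) , δqv) ,
        dom , 0 , v , Setoid.refl (RepresentedSpace.space (completion (Problem.target f))) , xv }
    where
    first copy : Fun 1
    first = oracleF (pairF zeroF v0)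
    -- Dropping the component index repeats the solution in every component; the successor encodes
    -- it in the completion.
    copy  = sucF (right $ (unpair₂F v0 ∷ []))
    copied : ∀ p q n k → fn right (join p q) (proj₂ (unpair (pair n k)) ∷ []) ≡ q k
    copied p q n k = trans (right-join p q _) (cong (q ∘ proj₂) (unpair-pair n k))

  -- A component of H's output that is not the name of a solution may name
  -- anything, so it gets whatever value the total representation of the
  -- completion assigns to it.

  stash-solution : ∀ (f : Problem ℓ) {x : ℕ → RepresentedSpace.Carrier (Problem.source f)} (r : Baire) n {q y} →
    (∀ m → Problem.dom f (x m)) →
    component r n -1≡ q → Graph (RepresentedSpace.δ (Problem.target f)) q y → Problem.Solution f (x n) y →
    ∃[ ys ] Graph (RepresentedSpace.δ (Problem.target (stash f))) r ys × Problem.Solution (stash f) x ys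
  stash-solution f r n {q} {y} dom r-1 δqy xy =
    (λ m → proj₁ (value m)) , (λ m → proj₂ (value m)) ,
    dom , n , y , δY̅.functional (proj₂ (value n)) (q , r-1 , δqy) , xy
    where
    Y = Problem.target f
    module δY̅ = PartialFunction (RepresentedSpace.δ (completion Y))
    value : ∀ m → ∃ (Graph (RepresentedSpace.δ (completion Y)) (component r m))
    value m = completion-total em Y (component r m)

  stash-dom : ∀ (f : Problem ℓ) {x : ℕ → RepresentedSpace.Carrier (Problem.source f)} →
              (∀ m → Problem.dom f (x m)) → Problem.dom (stash f) x
  stash-dom f dom = (λ m → just (proj₁ (dom m))) , dom , 0 , proj₁ (dom 0) ,
    Setoid.refl (RepresentedSpace.space (completion (Problem.target f))) , proj₂ (dom 0)

  componentwise : BairePartial ℓ → BairePartial ℓ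
  componentwise K = record
    { Graph      = λ p q → ∀ n → Graph K (component p n) (component q n)
    ; respˡ      = λ p≗p′ h n → K.respˡ (λ k → p≗p′ (pair n k)) (h n)
    ; respʳ      = λ q≗q′ h n → K.respʳ (λ k → q≗q′ (pair n k)) (h n)
    ; functional = λ {p} {q} {q′} h h′ m →
        subst (λ i → q i ≡ q′ i) (pair-unpair m) (K.functional (h (proj₁ (unpair m))) (h′ (proj₁ (unpair m))) (proj₂ (unpair m)))
    }
    where module K = PartialFunction K

  componentwise-admissible : ∀ {K} → Admissible K → Admissible (componentwise K)
  componentwise-admissible aK with Φ , approx ← approximable aK =
    -- For position `m`, `Φ` gets the component of `p` with index `unpair₁ m`, shifted by one since
    -- it is known in full at every stage.
    let stage = substF Φ (sucF (oracleF (pairF (unpair₁F v2) v0))) (v0 ∷ unpair₂F v1 ∷ []) in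
    admissible stage
      λ {p} {q} h m → subst (λ i → (λ t → fn stage p (t ∷ m ∷ [])) ⇝ q i) (pair-unpair m)
        (approx (h (proj₁ (unpair m))) {U = λ _ → suc ∘ component p (proj₁ (unpair m))}
          (λ i → ⇝-const _) (proj₂ (unpair m)))

  stash-mono : ∀ f g → f ≼ g → stash f ≼ stash g
  stash-mono f g f≼g with H , K , aH , aK , red ← ≼⇒reduction {f} {g} f≼g
    with Φ , approx ← approximable aH =
    reduction⇒≼ {stash f} {stash g} (total-admissible output) (componentwise-admissible aK) reduction
    where
    module f = Problem f
    module g = Problem g
    digits : Fun 3
    -- With arguments `i`, `n`, `t`: what the first `t` entries of component `n` of the solution
    -- reveal about its decoded entry `i`.
    digits = substF digitF (right $ (pairF v2 v0 ∷ [])) (v2 ∷ v0 ∷ [])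
    attempt : Fun 3
    -- With arguments stage, position and component: `Φ` is run on the digits known at that stage.
    attempt = substF Φ (joinF digits $ (v0 ∷ v3 ∷ v1 ∷ [])) (v0 ∷ v1 ∷ [])
    output : Fun 1
    output = emitF attempt $ (unpair₂F v0 ∷ unpair₁F v0 ∷ [])

    output-names : ∀ p q n {r o} → component q n -1≡ r → Graph H (join (component p n) r) o →
                   component (apply output (join p q)) n -1≡ o
    output-names p q n q-1 Hro = -1≡-respˡ
      (λ k → cong (λ { (n , k) → fn (emitF attempt) (join p q) (k ∷ n ∷ []) }) (sym (unpair-pair n k)))
      (emit-names {A = λ t j → fn attempt (join p q) (t ∷ j ∷ n ∷ [])}
        (approx Hro (joinF-approximates digits n
          (digit-approximates (-1≡-respˡ (λ k → sym (right-join p q (pair n k))) q-1)))))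

    reduction : IsReduction (stash f) (stash g) (total output) (componentwise K)
    reduction {p} {x} names (_ , dom , _) =
      tuple w , (λ n → K.respʳ (λ k → sym (component-tuple w n k)) (proj₁ (proj₂ (step n)))) ,
      u , (λ n → δU.respˡ (λ k → sym (component-tuple w n k)) (proj₁ (proj₂ (proj₂ (proj₂ (step n)))))) ,
      stash-dom g (λ n → proj₁ (proj₂ (proj₂ (proj₂ (proj₂ (step n)))))) ,
      solve
      where
      module K = PartialFunction K
      module δU = PartialFunction (RepresentedSpace.δ g.source)
      module V̅ = RepresentedSpace (completion g.target)
      module δV̅ = PartialFunction V̅.δ
      step = λ n → red (names n) (dom n)
      w : ℕ → Baire
      w n = proj₁ (step n)
      u = λ n → proj₁ (proj₂ (proj₂ (step n)))
      solve : ∀ {q v} → Graph (RepresentedSpace.δ (Problem.target (stash g))) q v →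
              Problem.Solution (stash g) u v →
              ∃[ r ] Graph (total output) (join p q) r ×
              (∃[ y ] Graph (RepresentedSpace.δ (Problem.target (stash f))) r y × Problem.Solution (stash f) x y)
      solve {q} {v} δqv (_ , n , z , vₙ≈z , uz)
        with r , q-1 , δrz ← δV̅.respʳ vₙ≈z (δqv n)
        with o , Hro , y , δoy , xy ← proj₂ (proj₂ (proj₂ (proj₂ (proj₂ (step n))))) δrz uz =
        apply output (join p q) , lift (λ _ → refl) ,
        stash-solution f (apply output (join p q)) n dom (output-names p q n q-1 Hro) δoy xy

  stash-≼-stash² : ∀ f → stash f ≼ stash (stash f)
  stash-≼-stash² f =
    reduction⇒≼ {stash f} {stash (stash f)} (total-admissible output) (total-admissible regroup) reduction
    where
    module f = Problem f
    regroup : Fun 1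
    -- Position ⟨m,⟨n,k⟩⟩ of the double sequence is read from position ⟨⟨m,n⟩,k⟩ of `p`.
    regroup = oracleF (pairF (pairF (unpair₁F v0) (unpair₁F (unpair₂F v0))) (unpair₂F (unpair₂F v0)))
    attempt : Fun 3
    -- Component ⟨m,n⟩ of the output is component `n` of the decoded component `m` of the solution.
    attempt = substF digitF (right $ (pairF (unpair₁F v3) v0 ∷ [])) (v0 ∷ pairF (unpair₂F v2) v1 ∷ [])
    output : Fun 1
    -- `emitF` adds a layer of blanks to a component that is itself a name in the completion;
    -- `predF` merges the two layers.
    output = predF (emitF attempt $ (unpair₂F v0 ∷ unpair₁F v0 ∷ []))

    regrouped : ∀ p m n k → apply regroup p (pair m (pair n k)) ≡ p (pair (pair m n) k)
    regrouped p m n k rewrite unpair-pair m (pair n k) | unpair-pair n k = refl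

    output-names : ∀ p q m n {r o} → component q m -1≡ r → component r n -1≡ o →
                   component (apply output (join p q)) (pair m n) -1≡ o
    output-names p q m n {r} q-1 r-1 = -1≡-respˡ
      (λ k → cong (λ { (n , k) → pred (fn (emitF attempt) (join p q) (k ∷ n ∷ [])) }) (sym (unpair-pair (pair m n) k)))
      (-1≡-pred (emit-names {A = λ t j → fn attempt (join p q) (t ∷ j ∷ pair m n ∷ [])} approx) r-1)
      where
      approx : (λ t j → fn attempt (join p q) (t ∷ j ∷ pair m n ∷ [])) Approximates component r n
      approx j rewrite unpair-pair m n =
        digit-approximates (-1≡-respˡ (λ k → sym (right-join p q (pair m k))) q-1) (pair n j)

    reduction : IsReduction (stash f) (stash (stash f)) (total output) (total regroup)
    reduction {p} {x} names (_ , dom , _) =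
      apply regroup p , lift (λ _ → refl) , (λ m n → x (pair m n)) ,
      (λ m n → δX.respˡ (λ k → sym (regrouped p m n k)) (names (pair m n))) ,
      stash-dom (stash f) (λ m → stash-dom f (λ n → dom (pair m n))) ,
      solve
      where
      module δX = PartialFunction (RepresentedSpace.δ f.source)
      module δY̅ = PartialFunction (RepresentedSpace.δ (completion f.target))
      module δY̅̅ = PartialFunction (RepresentedSpace.δ (completion (sequences (completion f.target))))
      solve : ∀ {q v} → Graph (RepresentedSpace.δ (Problem.target (stash (stash f)))) q v →
              Problem.Solution (stash (stash f)) (λ m n → x (pair m n)) v →
              ∃[ r ] Graph (total output) (join p q) r ×
              (∃[ y ] Graph (RepresentedSpace.δ (Problem.target (stash f))) r y × Problem.Solution (stash f) x y)
      solve {q} δqv (_ , m , z , vₘ≈z , _ , n , y , zₙ≈y , xy)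
        with r , q-1 , δrz ← δY̅̅.respʳ vₘ≈z (δqv m)
        with o , r-1 , δoy ← δY̅.respʳ zₙ≈y (δrz n) =
        apply output (join p q) , lift (λ _ → refl) ,
        stash-solution f (apply output (join p q)) (pair m n) dom (output-names p q m n q-1 r-1) δoy xy

  stash-interior : IsInteriorOperator _≼_ stash
  stash-interior = stash-≼ , stash-mono , stash-≼-stash²

proposition1p7 : ∀ {ℓ : Level} → ExcludedMiddle ℓ →
    IsInteriorOperator {ℓ} _≤W_ stash ×
    IsInteriorOperator {ℓ} _≤sW_ stash ×
    IsInteriorOperator {ℓ} _≤W*_ stash ×
    IsInteriorOperator {ℓ} _≤sW*_ stash
proposition1p7 em =
    stash-interior em computable-presentation (weak-joining computable-class)
  , stash-interior em computable-presentation (strong-joining computable-class)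
  , stash-interior em (continuous-presentation em) (weak-joining continuous-class)
  , stash-interior em (continuous-presentation em) (strong-joining continuous-class)
  where open StashIsInterior using (stash-interior)
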